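{- There exists $n_0$ such that for every even integer $n\geq n_0$ the following holds. Let $G$ be a triangle-free graph on $n$ vertices. Then \[ D_2^b(G)\leq \frac{n^2}{16}. \] Additionally, if $D_2^b(G)=\frac{n^2}{16}$, then $G\cong K_{\frac{3n}{4},\frac{n}{4}}$ (the complete bipartite graph with class sizes $3n/4$ and $n/4$).
   Context: For a graph $G$ and $A\subseteq V(G)$, $e(A)=e(G[A])$ denotes the number of edges of $G$ with both endpoints in $A$. A $k$-partition $V(G)=A_1\cup\dots\cup A_k$ is balanced if $|A_i|=|A_j|$ for all $i,j$. $D_k^b(G)=\min \sum_{i=1}^k e(A_i)$, where the minimum is over all balanced $k$-partitions of $V(G)$. -}

module Defs where

open import Data.Nat using (ℕ; zero; suc; _+_; _*_; _<_; _≤_; _<ᵇ_)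
import Data.Nat
import Data.Bool
import Data.Product
import Relation.Binary.PropositionalEquality
open import Data.Bool using (Bool; true; false; _xor_; _∧_; if_then_else_; T; not)
open import Data.Fin using (Fin; toℕ)
open import Data.List using (List; []; _∷_; map; filter; length; allFin; concatMap; foldr; sum)
open import Data.Vec using (Vec; []; _∷_; lookup)
open import Data.Product using (Σ; _×_; _,_)
open import Function.Bundles using (_↔_; Inverse)
open import Relation.Binary.PropositionalEquality using (_≡_)
open import Relation.Nullary using (¬_)

record Graph (n : ℕ) : Set where
  field
    adj   : Fin n → Fin n → Bool
    sym   : ∀ i j → adj i j ≡ adj j i
    irrefl : ∀ i → adj i i ≡ false
open Graph public

TriangleFree : ∀ {n} → Graph n → Set
TriangleFree G = ∀ i j k → ¬ (T (adj G i j) × T (adj G j k) × T (adj G i k))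

pairs : (n : ℕ) → List (Fin n × Fin n)
pairs n = concatMap (λ i → map (λ j → (i , j)) (filter (λ j → toℕ i Data.Nat.<? toℕ j) (allFin n))) (allFin n)

count : ∀ {n} → (Fin n → Bool) → ℕ
count {n} S = length (filter (λ v → Data.Bool._≟_ (S v) true) (allFin n))

eIn : ∀ {n} → Graph n → (Fin n → Bool) → ℕ
eIn {n} G S = length (filter (λ p → Data.Bool._≟_ (S (Data.Product.proj₁ p) ∧ S (Data.Product.proj₂ p) ∧ adj G (Data.Product.proj₁ p) (Data.Product.proj₂ p)) true) (pairs n))

-- a 2-partition V = A₁ ∪ A₂ encoded by its indicator S (A₁ = S⁻¹ true, A₂ = S⁻¹ false)
cost : ∀ {n} → Graph n → (Fin n → Bool) → ℕ
cost G S = eIn G S + eIn G (λ v → not (S v))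

Balanced : ∀ {n} → (Fin n → Bool) → Set
Balanced {n} S = count S ≡ count (λ v → not (S v))

-- D₂ᵇ(G) ≤ d  /  ≥ d, phrased directly via the minimum over balanced 2-partitions
-- (all 2-partitions of a finite set are the functions Fin n → Bool).
-- We represent the minimum value explicitly: D is D₂ᵇ(G) iff it is attained by a
-- balanced partition and is ≤ the cost of every balanced partition.
IsD2b : ∀ {n} → Graph n → ℕ → Set
IsD2b {n} G D = (Σ (Fin n → Bool) λ S → Balanced S × cost G S ≡ D)
              × (∀ S → Balanced S → D ≤ cost G S)

K : (a b : ℕ) → Graph (a + b)
K a b = record
  { adj = λ i j → (toℕ i <ᵇ a) xor (toℕ j <ᵇ a)
  ; sym = λ i j → xor-comm (toℕ i <ᵇ a) (toℕ j <ᵇ a)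
  ; irrefl = λ i → xor-self (toℕ i <ᵇ a) }
  where
  xor-comm : ∀ x y → x xor y ≡ y xor x
  xor-comm false false = Relation.Binary.PropositionalEquality.refl
  xor-comm false true = Relation.Binary.PropositionalEquality.refl
  xor-comm true false = Relation.Binary.PropositionalEquality.refl
  xor-comm true true = Relation.Binary.PropositionalEquality.refl
  xor-self : ∀ x → x xor x ≡ false
  xor-self false = Relation.Binary.PropositionalEquality.refl
  xor-self true = Relation.Binary.PropositionalEquality.refl

_≅_ : ∀ {n m} → Graph n → Graph m → Set
_≅_ {n} {m} G H = Σ (Fin n ↔ Fin m) λ f →
  ∀ i j → adj G i j ≡ adj H (Inverse.to f i) (Inverse.to f j)

{-# OPTIONS --safe #-}
module Submission where

-- Write n = 2 h, E for twice the number of edges, and suppose 4 D ≥ h². Let w be a vertex of degree d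
-- whose neighbours have degree sum s. Its neighbourhood N is independent, and a random balanced
-- partition with N inside one side (d ≤ h), or with one side inside N (d ≥ h), has an expected cost
-- depending only on d, s and E. As this is at least D,
--   slack w := (2 E - h²) d² + 4 h (E - h²) max (h - d , 0) - 4 h s d ≥ 0,
-- and the inequality is strict if d < h and some edge avoids N. A uniformly random balanced partition
-- shows E > h². In the other direction, a polynomial inequality in the degrees x, y of the ends of an
-- edge and in E, divided by x y and summed over all edges (where 1 / x sums to the number of
-- non-isolated vertices), yields that the slacks have sum at most 0. So they all vanish, and a
-- vertex w with d < h, which exists, has a neighbourhood meeting every edge. Hence G is bipartite with
-- classes of size d and n - d, and h² ≤ 4 d (h - d) forces h = 2 d and all edges between the classes.

open import Defs hiding (sym)

-- To leading order the slacks do not single out the extremal graph. They vanish for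
-- `K (3 n / 4) (n / 4)`, but also for the data of a regular graph of degree n / 3 (E = n² / 3, s =
-- d²). So the edge inequality must be tight at two points, (E / n² , x / n , y / n) = (3/8 , 1/4 ,
-- 3/4) and (1/3 , 1/3 , 1/3), which leaves little freedom in its coefficients. The second point is
-- ruled out by a lower-order term. The partitions are exactly balanced, so places are drawn without
-- replacement, and two free vertices share a side with a probability slightly below the (k² + j²) /
-- (k + j)² that the slack encodes. The difference is paid once for each edge avoiding N. It gives 4
-- θ h ρ ≤ (θ + h - 1) slack, where θ = h - d and ρ is twice the number of these edges. A vanishing
-- slack at a vertex of degree below h therefore yields ρ = 0 exactly, without stability arguments
-- and already for n ≥ 4.

module Proof where

  open import Data.Bool using (Bool; true; false; T; not; _∧_; _xor_; if_then_else_)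
  import Data.Bool
  open import Data.Bool.Properties using (T-∧)
  open import Data.Empty using (⊥; ⊥-elim)
  open import Data.Fin using (Fin; zero; suc; toℕ; fromℕ<; join)
  open import Data.Fin.Properties using (any?; toℕ-injective; toℕ<n; toℕ-↑ˡ; toℕ-↑ʳ; +↔⊎)
  open import Data.Integer hiding (suc)
  open import Data.Integer.Properties
  open import Data.Integer.Tactic.RingSolver using (solve-∀)
  open import Data.List using (List; []; _∷_; map; filter; length; allFin; concatMap; tabulate; _++_)
  open import Data.List.Properties using (length-++; filter-++)
  open import Data.Nat as ℕ using (ℕ; zero; suc; z≤n; s≤s; _!)
  open import Data.Nat.DivMod using (m*[n/m]≡n)
  open import Data.Nat.Divisibility using (m∣m*n; m≤n⇒m!∣n!; ∣-trans)
  import Data.Nat.Properties as ℕ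
  import Data.Nat.Tactic.RingSolver as ℕSolver
  open import Data.Product using (Σ; ∃; _×_; _,_; proj₁; proj₂)
  open import Data.Sum as Sum using (_⊎_; inj₁; inj₂; [_,_]′)
  open import Data.Unit using (tt)
  open import Data.Vec as Vec using (Vec; []; _∷_; lookup; replicate)
  open import Data.Vec.Functional using () renaming ([] to []ᶠ; _∷_ to _∷ᶠ_)
  open import Data.Vec.Properties using (lookup-map; lookup∘tabulate; lookup-replicate)
  open import Data.Vec.Relation.Unary.All using (All; []; _∷_)
  open import Function using (_∘_)
  open import Function.Bundles using (_↔_; Inverse; mk↔ₛ′; Equivalence)
  open import Function.Construct.Composition using (_↔-∘_)
  open import Function.Construct.Symmetry using (↔-sym)
  open import Level using (0ℓ)
  open import Relation.Binary.Definitions using (tri<; tri≈; tri>)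
  open import Relation.Binary.PropositionalEquality
  open import Relation.Nullary using (yes; no; does; contradiction)
  open import Relation.Nullary.Decidable using (dec-true; dec-false)
  open import Relation.Unary using (Pred; Decidable)
  open import Algebra.Properties.Semiring.Sum +-*-semiring
    using (sum; sum-cong-≗; ∑-distrib-+; ∑-comm; *-distribˡ-sum; *-distribʳ-sum)

  -- Sign of a polynomial on a cone

  0≤+ : ∀ {i j} → 0ℤ ≤ i → 0ℤ ≤ j → 0ℤ ≤ i + j
  0≤+ = +-mono-≤

  0≤* : ∀ {i j} → 0ℤ ≤ i → 0ℤ ≤ j → 0ℤ ≤ i * j
  0≤* {i} {j} p q = subst (_≤ i * j) (*-zeroʳ i) (*-monoˡ-≤-nonNeg i {{nonNegative p}} q)

  0≤i*i : ∀ i → 0ℤ ≤ i * i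
  0≤i*i (+ n)    = 0≤* {+ n} {+ n} (+≤+ z≤n) (+≤+ z≤n)
  0≤i*i -[1+ n ] = +≤+ z≤n

  0≤cancel : ∀ {i j} → 0ℤ < i → 0ℤ ≤ i * j → 0ℤ ≤ j
  0≤cancel {i} {j} p q =
    *-cancelˡ-≤-pos 0ℤ j i {{positive p}} (subst (_≤ i * j) (sym (*-zeroʳ i)) q)

  -- Recursive Horner form: a list of coefficients in powers of the first variable, each a
  -- polynomial in the others. The coefficients are data, so that evaluation can inspect their
  -- signs.
  Poly : ℕ → Set
  Poly zero    = ℤ
  Poly (suc n) = List (Poly n)

  eval : ∀ {n} → Poly n → Vec ℤ n → ℤ
  eval {zero}  c       ρ       = c
  eval {suc n} []      ρ       = 0ℤ
  eval {suc n} (c ∷ p) (x ∷ ρ) = eval c ρ + x * eval p (x ∷ ρ)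

  constₚ : ∀ {n} → ℤ → Poly n
  constₚ {zero}  c = c
  constₚ {suc n} c = constₚ c ∷ []

  varₚ : ∀ {n} → Fin n → Poly n
  varₚ zero    = constₚ 0ℤ ∷ constₚ 1ℤ ∷ []
  varₚ (suc i) = varₚ i ∷ []

  infixl 6 _+ₚ_
  infixl 7 _*ₚ_

  _+ₚ_ : ∀ {n} → Poly n → Poly n → Poly n
  _+ₚ_ {zero}  a       b       = a + b
  _+ₚ_ {suc n} []      q       = q
  _+ₚ_ {suc n} (a ∷ p) []      = a ∷ p
  _+ₚ_ {suc n} (a ∷ p) (b ∷ q) = (a +ₚ b) ∷ (p +ₚ q)

  -ₚ_ : ∀ {n} → Poly n → Poly n
  -ₚ_ {zero}  a       = - a
  -ₚ_ {suc n} []      = []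
  -ₚ_ {suc n} (a ∷ p) = (-ₚ a) ∷ (-ₚ p)

  _*ₚ_ : ∀ {n} → Poly n → Poly n → Poly n
  scaleₚ : ∀ {n} → Poly n → List (Poly n) → List (Poly n)
  _*ₚ_ {zero}  a       b = a * b
  _*ₚ_ {suc n} []      q = []
  _*ₚ_ {suc n} (a ∷ p) q = scaleₚ a q +ₚ (constₚ 0ℤ ∷ (p *ₚ q))
  scaleₚ a []      = []
  scaleₚ a (b ∷ q) = (a *ₚ b) ∷ scaleₚ a q

  eval-const : ∀ {n} c (ρ : Vec ℤ n) → eval (constₚ c) ρ ≡ c
  eval-const c []      = refl
  eval-const c (x ∷ ρ) =
    trans (cong₂ _+_ (eval-const c ρ) (*-zeroʳ x)) (+-identityʳ c)

  eval-var : ∀ {n} i (ρ : Vec ℤ n) → eval (varₚ i) ρ ≡ lookup ρ i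
  eval-var zero (x ∷ ρ)
    rewrite eval-const 0ℤ ρ | eval-const 1ℤ ρ = lemma x
    where
    lemma : ∀ y → 0ℤ + y * (1ℤ + y * 0ℤ) ≡ y
    lemma = solve-∀
  eval-var (suc i) (x ∷ ρ) =
    trans (cong₂ _+_ (eval-var i ρ) (*-zeroʳ x)) (+-identityʳ _)

  eval-+ : ∀ {n} p q (ρ : Vec ℤ n) → eval (p +ₚ q) ρ ≡ eval p ρ + eval q ρ
  eval-+ {zero}  a       b       ρ       = refl
  eval-+ {suc n} []      q       ρ       = sym (+-identityˡ _)
  eval-+ {suc n} (a ∷ p) []      ρ       = sym (+-identityʳ _)
  eval-+ {suc n} (a ∷ p) (b ∷ q) (x ∷ ρ)
    rewrite eval-+ a b ρ | eval-+ p q (x ∷ ρ) = lemma (eval a ρ) (eval b ρ) x _ _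
    where
    lemma : ∀ a b x p q → a + b + x * (p + q) ≡ a + x * p + (b + x * q)
    lemma = solve-∀

  eval-neg : ∀ {n} p (ρ : Vec ℤ n) → eval (-ₚ p) ρ ≡ - eval p ρ
  eval-neg {zero}  a       ρ       = refl
  eval-neg {suc n} []      ρ       = refl
  eval-neg {suc n} (a ∷ p) (x ∷ ρ)
    rewrite eval-neg a ρ | eval-neg p (x ∷ ρ) = lemma (eval a ρ) x _
    where
    lemma : ∀ a x p → - a + x * - p ≡ - (a + x * p)
    lemma = solve-∀

  eval-* : ∀ {n} p q (ρ : Vec ℤ n) → eval (p *ₚ q) ρ ≡ eval p ρ * eval q ρ
  eval-scale : ∀ {n} a q x (ρ : Vec ℤ n) → eval (scaleₚ a q) (x ∷ ρ) ≡ eval a ρ * eval q (x ∷ ρ)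
  eval-* {zero}  a       b ρ       = refl
  eval-* {suc n} []      q ρ       = refl
  eval-* {suc n} (a ∷ p) q (x ∷ ρ)
    rewrite eval-+ (scaleₚ a q) (constₚ 0ℤ ∷ (p *ₚ q)) (x ∷ ρ)
          | eval-scale a q x ρ | eval-const 0ℤ ρ | eval-* p q (x ∷ ρ)
    = lemma (eval a ρ) x _ _
    where
    lemma : ∀ a x p q → a * q + (0ℤ + x * (p * q)) ≡ (a + x * p) * q
    lemma = solve-∀
  eval-scale a []      x ρ = sym (*-zeroʳ (eval a ρ))
  eval-scale a (b ∷ q) x ρ
    rewrite eval-* a b ρ | eval-scale a q x ρ = lemma (eval a ρ) (eval b ρ) x _
    where
    lemma : ∀ a b x q → a * b + x * (a * q) ≡ a * (b + x * q)
    lemma = solve-∀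

  infixl 6 _⊕_ _⊝_
  infixl 7 _⊗_

  data Expr (n : ℕ) : Set where
    con : ℤ → Expr n
    var : Fin n → Expr n
    _⊕_ _⊝_ _⊗_ : Expr n → Expr n → Expr n

  ⟦_⟧ : ∀ {n} → Expr n → Vec ℤ n → ℤ
  ⟦ con c ⟧ ρ = c
  ⟦ var i ⟧ ρ = lookup ρ i
  ⟦ e ⊕ f ⟧ ρ = ⟦ e ⟧ ρ + ⟦ f ⟧ ρ
  ⟦ e ⊝ f ⟧ ρ = ⟦ e ⟧ ρ - ⟦ f ⟧ ρ
  ⟦ e ⊗ f ⟧ ρ = ⟦ e ⟧ ρ * ⟦ f ⟧ ρ

  norm : ∀ {n} → Expr n → Poly n
  norm (con c) = constₚ c
  norm (var i) = varₚ i
  norm (e ⊕ f) = norm e +ₚ norm f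
  norm (e ⊝ f) = norm e +ₚ (-ₚ norm f)
  norm (e ⊗ f) = norm e *ₚ norm f

  norm-correct : ∀ {n} e (ρ : Vec ℤ n) → eval (norm e) ρ ≡ ⟦ e ⟧ ρ
  norm-correct (con c) ρ = eval-const c ρ
  norm-correct (var i) ρ = eval-var i ρ
  norm-correct (e ⊕ f) ρ =
    trans (eval-+ (norm e) (norm f) ρ) (cong₂ _+_ (norm-correct e ρ) (norm-correct f ρ))
  norm-correct (e ⊝ f) ρ =
    trans (eval-+ (norm e) (-ₚ norm f) ρ)
      (cong₂ _+_ (norm-correct e ρ)
        (trans (eval-neg (norm f) ρ) (cong -_ (norm-correct f ρ))))
  norm-correct (e ⊗ f) ρ =
    trans (eval-* (norm e) (norm f) ρ) (cong₂ _*_ (norm-correct e ρ) (norm-correct f ρ))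

  nonNegCoeffs : ∀ {n} → Poly n → Bool
  nonNegCoeffs {zero}  c       = 0ℤ ≤ᵇ c
  nonNegCoeffs {suc n} []      = true
  nonNegCoeffs {suc n} (a ∷ p) = nonNegCoeffs a ∧ nonNegCoeffs p

  eval-nonNeg : ∀ {n} (p : Poly n) {ρ} → T (nonNegCoeffs p) → All (0ℤ ≤_) ρ → 0ℤ ≤ eval p ρ
  eval-nonNeg {zero}  c       t _         = ≤ᵇ⇒≤ t
  eval-nonNeg {suc n} []      t _         = ≤-refl
  eval-nonNeg {suc n} (a ∷ p) t (x≥0 ∷ h) =
    let ta , tp = Equivalence.to T-∧ t in
    0≤+ (eval-nonNeg a ta h) (0≤* x≥0 (eval-nonNeg p tp (x≥0 ∷ h)))

  substitute : ∀ {m n} → Vec (Expr n) m → Expr m → Expr n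
  substitute σ (con c) = con c
  substitute σ (var i) = lookup σ i
  substitute σ (e ⊕ f) = substitute σ e ⊕ substitute σ f
  substitute σ (e ⊝ f) = substitute σ e ⊝ substitute σ f
  substitute σ (e ⊗ f) = substitute σ e ⊗ substitute σ f

  ⟦substitute⟧ : ∀ {m n} (σ : Vec (Expr n) m) e ρ →
    ⟦ substitute σ e ⟧ ρ ≡ ⟦ e ⟧ (Vec.map (λ f → ⟦ f ⟧ ρ) σ)
  ⟦substitute⟧ σ (con c) ρ = refl
  ⟦substitute⟧ σ (var i) ρ = sym (lookup-map i (λ f → ⟦ f ⟧ ρ) σ)
  ⟦substitute⟧ σ (e ⊕ f) ρ = cong₂ _+_ (⟦substitute⟧ σ e ρ) (⟦substitute⟧ σ f ρ)
  ⟦substitute⟧ σ (e ⊝ f) ρ = cong₂ _-_ (⟦substitute⟧ σ e ρ) (⟦substitute⟧ σ f ρ)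
  ⟦substitute⟧ σ (e ⊗ f) ρ = cong₂ _*_ (⟦substitute⟧ σ e ρ) (⟦substitute⟧ σ f ρ)

  -- The implicit argument t is found by evaluation, whenever e, written in the coordinates of the
  -- cone spanned by a, b, c, has no negative coefficient.
  module _ (e : Expr 3) (a₁ a₂ a₃ b₁ b₂ b₃ c₁ c₂ c₃ : ℕ) where
    private
      row : ℕ → ℕ → ℕ → Expr 3
      row u v w = con (+ u) ⊗ var zero ⊕ con (+ v) ⊗ var (suc zero) ⊕ con (+ w) ⊗ var (suc (suc zero))

      rows : Vec (Expr 3) 3
      rows = row a₁ b₁ c₁ ∷ row a₂ b₂ c₂ ∷ row a₃ b₃ c₃ ∷ []

    nonNegOnCone : ∀ {t : T (nonNegCoeffs (norm (substitute rows e)))} α β γ x y z →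
      0ℤ ≤ α → 0ℤ ≤ β → 0ℤ ≤ γ →
      + a₁ * α + + b₁ * β + + c₁ * γ ≡ x →
      + a₂ * α + + b₂ * β + + c₂ * γ ≡ y →
      + a₃ * α + + b₃ * β + + c₃ * γ ≡ z →
      0ℤ ≤ ⟦ e ⟧ (x ∷ y ∷ z ∷ [])
    nonNegOnCone {t} α β γ _ _ _ hα hβ hγ refl refl refl =
      subst (0ℤ ≤_) (trans (norm-correct (substitute rows e) ρ) (⟦substitute⟧ rows e ρ))
        (eval-nonNeg (norm (substitute rows e)) t (hα ∷ hβ ∷ hγ ∷ []))
      where ρ = α ∷ β ∷ γ ∷ []

  -- The edge inequality

  0<* : ∀ {i j} → 0ℤ < i → 0ℤ < j → 0ℤ < i * j
  0<* {i} {j} p q = subst (_< i * j) (*-zeroʳ i) (*-monoˡ-<-pos i {{positive p}} q)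

  pattern x̂ = var zero
  pattern ŷ = var (suc zero)
  pattern l̂ = var (suc (suc zero))

  -- LL stands for an edge with both degrees at most n / 2, LH for one with a larger degree Y.
  -- In edgeGap below, the cubic term in P is removed by means of P (3 P - L)² ≥ 0 (LL) and
  -- P (8 P - 3 L)² ≥ 0 (LH); what remains is a multiple of A P² - B P + C.
  A-LL B-LL C-LL A-LH B-LH C-LH : Expr 3
  A-LL = con (+ 165) ⊗ (x̂ ⊕ ŷ) ⊗ l̂ ⊝ con (+ 144) ⊗ x̂ ⊗ ŷ
  B-LL = con (+ 72) ⊗ x̂ ⊗ ŷ ⊗ (x̂ ⊕ ŷ) ⊕ con (+ 90) ⊗ x̂ ⊗ ŷ ⊗ l̂
    ⊕ con (+ 71) ⊗ (x̂ ⊕ ŷ) ⊗ l̂ ⊗ l̂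
  C-LL = con (+ 9) ⊗ (con (+ 16) ⊗ x̂ ⊗ x̂ ⊗ ŷ ⊗ ŷ ⊕ x̂ ⊗ ŷ ⊗ (x̂ ⊕ ŷ) ⊗ l̂ ⊕ con (+ 2) ⊗ x̂ ⊗ ŷ ⊗ l̂ ⊗ l̂
    ⊕ (x̂ ⊕ ŷ) ⊗ l̂ ⊗ l̂ ⊗ l̂)
  A-LH = con (+ 152) ⊗ (x̂ ⊕ ŷ) ⊗ l̂ ⊝ con (+ 128) ⊗ x̂ ⊗ ŷ
  B-LH = con (+ 64) ⊗ x̂ ⊗ ŷ ⊗ (x̂ ⊕ ŷ) ⊕ con (+ 144) ⊗ x̂ ⊗ ŷ ⊗ l̂
    ⊕ (con (+ 33) ⊗ x̂ ⊕ con (+ 65) ⊗ ŷ) ⊗ l̂ ⊗ l̂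
  C-LH = con (+ 8) ⊗ (con (+ 16) ⊗ x̂ ⊗ x̂ ⊗ ŷ ⊗ ŷ ⊕ x̂ ⊗ ŷ ⊗ (x̂ ⊕ ŷ) ⊗ l̂ ⊕ con (+ 4) ⊗ x̂ ⊗ ŷ ⊗ l̂ ⊗ l̂
    ⊕ ŷ ⊗ l̂ ⊗ l̂ ⊗ l̂)

  -- With the sign opposite to the usual one, so that being nonnegative is the favourable case for a
  -- p² - b p + c.
  discriminant : Expr 3 → Expr 3 → Expr 3 → Expr 3
  discriminant a b c = con (+ 4) ⊗ a ⊗ c ⊝ b ⊗ b

  -- Completing the square: 4 A (A p² - B p + C) = (2 A p - B)² + (4 A C - B²). The term `R` takes
  -- the multiple of a square that absorbs the cubic part in p.
  quadratic-nonNeg : ∀ A B C R p → 0ℤ < A → 0ℤ ≤ + 4 * A * C - B * B → 0ℤ ≤ R →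
    0ℤ ≤ A * p * p - B * p + C + R
  quadratic-nonNeg A B C R p A>0 disc R≥0 =
    0≤cancel (0<* {+ 4} {A} (+<+ (s≤s z≤n)) A>0) (subst (0ℤ ≤_) (identity A B C R p)
      (0≤+ (0≤+ (0≤i*i (+ 2 * A * p - B)) disc) (0≤* (0≤* {+ 4} {A} (+≤+ z≤n) (<⇒≤ A>0)) R≥0)))
    where
    identity : ∀ A B C R p →
      (+ 2 * A * p - B) * (+ 2 * A * p - B) + (+ 4 * A * C - B * B) + + 4 * A * R
        ≡ + 4 * A * (A * p * p - B * p + C + R)
    identity = solve-∀

  -- The two discriminants vanish at (1 , 1 , 3) and (1 , 3 , 4), the degrees in a regular graph of
  -- degree n / 3 and in K (3 n / 4) (n / 4); the region is cut into cones having that point as a generator.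
  LL-disc : ∀ X Y L → 0ℤ ≤ X → X ≤ Y → + 2 * Y ≤ L →
    0ℤ ≤ ⟦ discriminant A-LL B-LL C-LL ⟧ (X ∷ Y ∷ L ∷ [])
  LL-disc X Y L hX hXY hY =
    -- The region has the rays (0 , 0 , 1), (0 , 1 , 2), (1 , 1 , 2), and (1 , 1 , 3) lies on its
    -- face X = Y. A form with nonnegative coefficients that vanishes inside a face of a cone
    -- vanishes on the whole face, so this zero has to be a generator. The part next to 2 Y = L is
    -- cut once more, at (1 , 2 , 4).
    [ cone₁ , (λ h → [ cone₂ h , cone₃ ]′ (≤-total (+ 2 * X + Y) L)) ]′ (≤-total (X + + 2 * Y) L)
    where
    goal = 0ℤ ≤ ⟦ discriminant A-LL B-LL C-LL ⟧ (X ∷ Y ∷ L ∷ [])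

    cone₁ : X + + 2 * Y ≤ L → goal
    cone₁ h =
      nonNegOnCone (discriminant A-LL B-LL C-LL) 1 1 3 0 1 2 0 0 1
        X (Y - X) (L - (X + + 2 * Y)) X Y L
        hX (i≤j⇒0≤j-i hXY) (i≤j⇒0≤j-i h) (e₁ X Y L) (e₂ X Y L) (e₃ X Y L)
      where
      e₁ : ∀ X Y L → + 1 * X + + 0 * (Y - X) + + 0 * (L - (X + + 2 * Y)) ≡ X
      e₁ = solve-∀
      e₂ : ∀ X Y L → + 1 * X + + 1 * (Y - X) + + 0 * (L - (X + + 2 * Y)) ≡ Y
      e₂ = solve-∀
      e₃ : ∀ X Y L → + 3 * X + + 2 * (Y - X) + + 1 * (L - (X + + 2 * Y)) ≡ L
      e₃ = solve-∀

    cone₂ : L ≤ X + + 2 * Y → + 2 * X + Y ≤ L → goal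
    cone₂ h h′ =
      nonNegOnCone (discriminant A-LL B-LL C-LL) 1 1 3 0 1 2 1 2 4
        (L - + 2 * Y) (L - (+ 2 * X + Y)) (X + + 2 * Y - L) X Y L
        (i≤j⇒0≤j-i hY) (i≤j⇒0≤j-i h′) (i≤j⇒0≤j-i h) (e₁ X Y L) (e₂ X Y L) (e₃ X Y L)
      where
      e₁ : ∀ X Y L → + 1 * (L - + 2 * Y) + + 0 * (L - (+ 2 * X + Y)) + + 1 * (X + + 2 * Y - L) ≡ X
      e₁ = solve-∀
      e₂ : ∀ X Y L → + 1 * (L - + 2 * Y) + + 1 * (L - (+ 2 * X + Y)) + + 2 * (X + + 2 * Y - L) ≡ Y
      e₂ = solve-∀
      e₃ : ∀ X Y L → + 3 * (L - + 2 * Y) + + 2 * (L - (+ 2 * X + Y)) + + 4 * (X + + 2 * Y - L) ≡ L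
      e₃ = solve-∀

    cone₃ : L ≤ + 2 * X + Y → goal
    cone₃ h =
      nonNegOnCone (discriminant A-LL B-LL C-LL) 1 1 3 1 2 4 1 1 2
        (L - + 2 * Y) (Y - X) (+ 2 * X + Y - L) X Y L
        (i≤j⇒0≤j-i hY) (i≤j⇒0≤j-i hXY) (i≤j⇒0≤j-i h) (e₁ X Y L) (e₂ X Y L) (e₃ X Y L)
      where
      e₁ : ∀ X Y L → + 1 * (L - + 2 * Y) + + 1 * (Y - X) + + 1 * (+ 2 * X + Y - L) ≡ X
      e₁ = solve-∀
      e₂ : ∀ X Y L → + 1 * (L - + 2 * Y) + + 2 * (Y - X) + + 1 * (+ 2 * X + Y - L) ≡ Y
      e₂ = solve-∀
      e₃ : ∀ X Y L → + 3 * (L - + 2 * Y) + + 4 * (Y - X) + + 2 * (+ 2 * X + Y - L) ≡ L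
      e₃ = solve-∀

  ⟦norm-≡⟧ : ∀ {n} (e f : Expr n) → norm e ≡ norm f → ∀ ρ → ⟦ e ⟧ ρ ≡ ⟦ f ⟧ ρ
  ⟦norm-≡⟧ e f eq ρ = trans (sym (norm-correct e ρ)) (trans (cong (λ p → eval p ρ) eq) (norm-correct f ρ))

  double : Vec (Expr 3) 3
  double = con (+ 2) ⊗ x̂ ∷ con (+ 2) ⊗ ŷ ∷ con (+ 2) ⊗ l̂ ∷ []

  -- `cone₂` and `cone₃` of `LH-disc` have determinant 2 up to sign, so only doubled points are sure
  -- to have integral coordinates there. The discriminant is homogeneous of degree 6, whence the
  -- factor 64.
  LH-disc-double :
    norm (substitute double (discriminant A-LH B-LH C-LH)) ≡ norm (con (+ 64) ⊗ discriminant A-LH B-LH C-LH)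
  LH-disc-double = refl

  LH-disc : ∀ X Y L → 0ℤ ≤ X → L ≤ + 2 * Y → X + Y ≤ L →
    0ℤ ≤ ⟦ discriminant A-LH B-LH C-LH ⟧ (X ∷ Y ∷ L ∷ [])
  LH-disc X Y L hX hY hXY =
    [ cone₁ , (λ h → undouble ([ cone₂ h , cone₃ ]′ (≤-total (+ 4 * X) L))) ]′
      (≤-total (L + + 2 * X) (+ 2 * Y))
    where
    goal = 0ℤ ≤ ⟦ discriminant A-LH B-LH C-LH ⟧ (X ∷ Y ∷ L ∷ [])
    goal₂ = 0ℤ ≤ ⟦ discriminant A-LH B-LH C-LH ⟧ (+ 2 * X ∷ + 2 * Y ∷ + 2 * L ∷ [])

    undouble : goal₂ → goal
    undouble h = 0≤cancel {+ 64} (+<+ (s≤s z≤n)) (subst (0ℤ ≤_)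
      (trans (sym (⟦substitute⟧ double (discriminant A-LH B-LH C-LH) (X ∷ Y ∷ L ∷ [])))
        (⟦norm-≡⟧ (substitute double (discriminant A-LH B-LH C-LH))
          (con (+ 64) ⊗ discriminant A-LH B-LH C-LH) LH-disc-double (X ∷ Y ∷ L ∷ []))) h)

    cone₁ : L + + 2 * X ≤ + 2 * Y → goal
    cone₁ h =
      nonNegOnCone (discriminant A-LH B-LH C-LH) 1 3 4 0 1 2 0 1 1
        X (L - (X + Y)) (+ 2 * Y - (L + + 2 * X)) X Y L
        hX (i≤j⇒0≤j-i hXY) (i≤j⇒0≤j-i h) (e₁ X Y L) (e₂ X Y L) (e₃ X Y L)
      where
      e₁ : ∀ X Y L → + 1 * X + + 0 * (L - (X + Y)) + + 0 * (+ 2 * Y - (L + + 2 * X)) ≡ X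
      e₁ = solve-∀
      e₂ : ∀ X Y L → + 3 * X + + 1 * (L - (X + Y)) + + 1 * (+ 2 * Y - (L + + 2 * X)) ≡ Y
      e₂ = solve-∀
      e₃ : ∀ X Y L → + 4 * X + + 2 * (L - (X + Y)) + + 1 * (+ 2 * Y - (L + + 2 * X)) ≡ L
      e₃ = solve-∀

    cone₂ : + 2 * Y ≤ L + + 2 * X → + 4 * X ≤ L → goal₂
    cone₂ h h′ =
      nonNegOnCone (discriminant A-LH B-LH C-LH) 1 3 4 0 1 2 1 2 4
        (+ 2 * Y - L) (L - + 4 * X) (L + + 2 * X - + 2 * Y) (+ 2 * X) (+ 2 * Y) (+ 2 * L)
        (i≤j⇒0≤j-i hY) (i≤j⇒0≤j-i h′) (i≤j⇒0≤j-i h) (e₁ X Y L) (e₂ X Y L) (e₃ X Y L)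
      where
      e₁ : ∀ X Y L → + 1 * (+ 2 * Y - L) + + 0 * (L - + 4 * X) + + 1 * (L + + 2 * X - + 2 * Y) ≡ + 2 * X
      e₁ = solve-∀
      e₂ : ∀ X Y L → + 3 * (+ 2 * Y - L) + + 1 * (L - + 4 * X) + + 2 * (L + + 2 * X - + 2 * Y) ≡ + 2 * Y
      e₂ = solve-∀
      e₃ : ∀ X Y L → + 4 * (+ 2 * Y - L) + + 2 * (L - + 4 * X) + + 4 * (L + + 2 * X - + 2 * Y) ≡ + 2 * L
      e₃ = solve-∀

    cone₃ : L ≤ + 4 * X → goal₂
    cone₃ h =
      nonNegOnCone (discriminant A-LH B-LH C-LH) 1 3 4 1 1 2 1 2 4
        (+ 2 * Y - L) (+ 4 * X - L) (+ 2 * (L - (X + Y))) (+ 2 * X) (+ 2 * Y) (+ 2 * L)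
        (i≤j⇒0≤j-i hY) (i≤j⇒0≤j-i h) (0≤* {+ 2} {L - (X + Y)} (+≤+ z≤n) (i≤j⇒0≤j-i hXY)) (e₁ X Y L) (e₂ X Y L) (e₃ X Y L)
      where
      e₁ : ∀ X Y L → + 1 * (+ 2 * Y - L) + + 1 * (+ 4 * X - L) + + 1 * (+ 2 * (L - (X + Y))) ≡ + 2 * X
      e₁ = solve-∀
      e₂ : ∀ X Y L → + 3 * (+ 2 * Y - L) + + 1 * (+ 4 * X - L) + + 2 * (+ 2 * (L - (X + Y))) ≡ + 2 * Y
      e₂ = solve-∀
      e₃ : ∀ X Y L → + 4 * (+ 2 * Y - L) + + 2 * (+ 4 * X - L) + + 4 * (+ 2 * (L - (X + Y))) ≡ + 2 * L
      e₃ = solve-∀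

  -- P Λ is the multiplier of the constraint that 1 / X sums to a constant over all edges. It is chosen
  -- so that edgeGap vanishes to second order at (P , X , Y) = (1 / 3 , 1 / 3 , 1 / 3) and at
  -- (3 / 8 , 1 / 4 , 3 / 4), taking L = 1; there its value is forced.
  Λ : ℤ → ℤ → ℤ
  Λ P L = + 8 * P * P + + 13 * P * L - + 3 * L * L

  -- To be read with P = E, L = N², X = N x, Y = N y. In a sum of slacks only the terms s d involve
  -- two vertices, and they sum to x y over ordered edges; any other vertex sum of f (d) is an edge
  -- sum of f (x) / x. After division by X Y the five terms become x y, 1 / x, x, θ / x and a
  -- constant.
  edgeGap : (P L X Y θX θY : ℤ) → ℤ
  edgeGap P L X Y θX θY =
    + 16 * X * X * Y * Y + P * Λ P L * (X + Y)
    - ((+ 8 * P - L) * X * Y * (X + Y) + (+ 4 * P - L) * L * (Y * θX + X * θY) + + 2 * Λ P L * X * Y)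

  LL-identity : ∀ P L X Y →
    (+ 165 * (X + Y) * L - + 144 * X * Y) * P * P
    - (+ 72 * X * Y * (X + Y) + + 90 * X * Y * L + + 71 * (X + Y) * L * L) * P
    + + 9 * (+ 16 * X * X * Y * Y + X * Y * (X + Y) * L + + 2 * X * Y * L * L + (X + Y) * L * L * L)
    + + 8 * (X + Y) * P * ((+ 3 * P - L) * (+ 3 * P - L))
    ≡ + 9 * edgeGap P L X Y (L - + 2 * X) (L - + 2 * Y)
  LL-identity = identity
    where
    identity : ∀ P L X Y →
      (+ 165 * (X + Y) * L - + 144 * X * Y) * P * P
      - (+ 72 * X * Y * (X + Y) + + 90 * X * Y * L + + 71 * (X + Y) * L * L) * P
      + + 9 * (+ 16 * X * X * Y * Y + X * Y * (X + Y) * L + + 2 * X * Y * L * L + (X + Y) * L * L * L)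
      + + 8 * (X + Y) * P * ((+ 3 * P - L) * (+ 3 * P - L))
      ≡ + 9 * (+ 16 * X * X * Y * Y + P * (+ 8 * P * P + + 13 * P * L - + 3 * L * L) * (X + Y)
        - ((+ 8 * P - L) * X * Y * (X + Y) + (+ 4 * P - L) * L * (Y * (L - + 2 * X) + X * (L - + 2 * Y))
           + + 2 * (+ 8 * P * P + + 13 * P * L - + 3 * L * L) * X * Y))
    identity = solve-∀

  LH-identity : ∀ P L X Y →
    (+ 152 * (X + Y) * L - + 128 * X * Y) * P * P
    - (+ 64 * X * Y * (X + Y) + + 144 * X * Y * L + (+ 33 * X + + 65 * Y) * L * L) * P
    + + 8 * (+ 16 * X * X * Y * Y + X * Y * (X + Y) * L + + 4 * X * Y * L * L + Y * L * L * L)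
    + (X + Y) * P * ((+ 8 * P - + 3 * L) * (+ 8 * P - + 3 * L))
    ≡ + 8 * edgeGap P L X Y (L - + 2 * X) 0ℤ
  LH-identity = identity
    where
    identity : ∀ P L X Y →
      (+ 152 * (X + Y) * L - + 128 * X * Y) * P * P
      - (+ 64 * X * Y * (X + Y) + + 144 * X * Y * L + (+ 33 * X + + 65 * Y) * L * L) * P
      + + 8 * (+ 16 * X * X * Y * Y + X * Y * (X + Y) * L + + 4 * X * Y * L * L + Y * L * L * L)
      + (X + Y) * P * ((+ 8 * P - + 3 * L) * (+ 8 * P - + 3 * L))
      ≡ + 8 * (+ 16 * X * X * Y * Y + P * (+ 8 * P * P + + 13 * P * L - + 3 * L * L) * (X + Y)
        - ((+ 8 * P - L) * X * Y * (X + Y) + (+ 4 * P - L) * L * (Y * (L - + 2 * X) + X * 0ℤ)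
           + + 2 * (+ 8 * P * P + + 13 * P * L - + 3 * L * L) * X * Y))
    identity = solve-∀

  -- The shape of `A-LL` (165 = 21 + 144) and `A-LH` (152 = 24 + 128). Since Y ≤ L, the term b X L
  -- pays for b X Y, and a positive multiple of Y L is left over.
  leading-pos : ∀ {X Y L} a b → 0ℤ ≤ X → 0ℤ < Y → Y ≤ L →
    0ℤ < (+ suc a + + b) * (X + Y) * L - + b * X * Y
  leading-pos {X} {Y} {L} a b X≥0 Y>0 Y≤L = subst (0ℤ <_) (identity (+ suc a) (+ b) X Y L)
    (+-mono-<-≤
      (0<* {+ suc a + + b} {Y * L} (+<+ (s≤s z≤n)) (0<* Y>0 L>0))
      (0≤* X≥0 (0≤+ (0≤* {+ suc a} {L} (+≤+ z≤n) (<⇒≤ L>0)) (0≤* {+ b} {L - Y} (+≤+ z≤n) (i≤j⇒0≤j-i Y≤L)))))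
    where
    L>0 = <-≤-trans Y>0 Y≤L
    identity : ∀ a b X Y L → (a + b) * (Y * L) + X * (a * L + b * (L - Y)) ≡ (a + b) * (X + Y) * L - b * X * Y
    identity = solve-∀

  edgeGap-sym : ∀ P L X Y θX θY → edgeGap P L X Y θX θY ≡ edgeGap P L Y X θY θX
  edgeGap-sym P L X Y θX θY = identity P L (Λ P L) X Y θX θY
    where
    identity : ∀ P L Λ X Y θX θY →
      + 16 * X * X * Y * Y + P * Λ * (X + Y)
      - ((+ 8 * P - L) * X * Y * (X + Y) + (+ 4 * P - L) * L * (Y * θX + X * θY) + + 2 * Λ * X * Y)
      ≡ + 16 * Y * Y * X * X + P * Λ * (Y + X)
      - ((+ 8 * P - L) * Y * X * (Y + X) + (+ 4 * P - L) * L * (X * θY + Y * θX) + + 2 * Λ * Y * X)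
    identity = solve-∀

  -- θ = max (L - 2 X , 0), as two cases whose equations can be matched on; they decide between LL
  -- and LH.
  Excess : (L X θ : ℤ) → Set
  Excess L X θ = (+ 2 * X ≤ L × θ ≡ L - + 2 * X) ⊎ (L < + 2 * X × θ ≡ 0ℤ)

  edgeGap-LL : ∀ P L X Y → 0ℤ ≤ P → 0ℤ ≤ X → X ≤ Y → 0ℤ < Y → + 2 * Y ≤ L →
    0ℤ ≤ edgeGap P L X Y (L - + 2 * X) (L - + 2 * Y)
  edgeGap-LL P L X Y P≥0 X≥0 X≤Y Y>0 2Y≤L = 0≤cancel {+ 9} (+<+ (s≤s z≤n))
    (subst (0ℤ ≤_) (LL-identity P L X Y)
      (quadratic-nonNeg (⟦ A-LL ⟧ v) (⟦ B-LL ⟧ v) (⟦ C-LL ⟧ v)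
        (+ 8 * (X + Y) * P * ((+ 3 * P - L) * (+ 3 * P - L))) P
        (leading-pos 20 144 X≥0 Y>0 Y≤L) (LL-disc X Y L X≥0 X≤Y 2Y≤L)
        (0≤* {+ 8 * (X + Y) * P} (0≤* {+ 8 * (X + Y)} {P} (0≤* {+ 8} {X + Y} (+≤+ z≤n) (0≤+ X≥0 (<⇒≤ Y>0))) P≥0)
          (0≤i*i (+ 3 * P - L)))))
    where
    v = X ∷ Y ∷ L ∷ []
    Y≤L : Y ≤ L
    Y≤L = ≤-trans (subst (_≤ + 2 * Y) (*-identityˡ Y)
      (*-monoʳ-≤-nonNeg Y {{nonNegative (<⇒≤ Y>0)}} {+ 1} {+ 2} (+≤+ (s≤s z≤n)))) 2Y≤L

  edgeGap-LH : ∀ P L X Y → 0ℤ ≤ P → 0ℤ ≤ X → 0ℤ < Y → L ≤ + 2 * Y → X + Y ≤ L →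
    0ℤ ≤ edgeGap P L X Y (L - + 2 * X) 0ℤ
  edgeGap-LH P L X Y P≥0 X≥0 Y>0 L≤2Y X+Y≤L = 0≤cancel {+ 8} (+<+ (s≤s z≤n))
    (subst (0ℤ ≤_) (LH-identity P L X Y)
      (quadratic-nonNeg (⟦ A-LH ⟧ v) (⟦ B-LH ⟧ v) (⟦ C-LH ⟧ v)
        ((X + Y) * P * ((+ 8 * P - + 3 * L) * (+ 8 * P - + 3 * L))) P
        (leading-pos 23 128 X≥0 Y>0 Y≤L) (LH-disc X Y L X≥0 L≤2Y X+Y≤L)
        (0≤* {(X + Y) * P} (0≤* {X + Y} {P} (0≤+ X≥0 (<⇒≤ Y>0)) P≥0) (0≤i*i (+ 8 * P - + 3 * L)))))
    where
    v = X ∷ Y ∷ L ∷ []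
    Y≤L : Y ≤ L
    Y≤L = ≤-trans (subst (_≤ X + Y) (+-identityˡ Y) (+-monoˡ-≤ Y X≥0)) X+Y≤L

  edgeGap-ordered : ∀ P L X Y θX θY → 0ℤ ≤ P → 0ℤ ≤ X → X ≤ Y → 0ℤ < Y → X + Y ≤ L →
    Excess L X θX → Excess L Y θY → 0ℤ ≤ edgeGap P L X Y θX θY
  edgeGap-ordered P L X Y _ _ hP hX hXY hY h (inj₁ (_ , refl)) (inj₁ (k , refl)) = edgeGap-LL P L X Y hP hX hXY hY k
  edgeGap-ordered P L X Y _ _ hP hX hXY hY h (inj₁ (_ , refl)) (inj₂ (k , refl)) = edgeGap-LH P L X Y hP hX hY (<⇒≤ k) h
  edgeGap-ordered P L X Y _ _ hP hX hXY hY h (inj₂ (k , _)) _ =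
    ⊥-elim (<⇒≱ k (≤-trans (subst (_≤ X + Y) (double-+ X) (+-monoʳ-≤ X hXY)) h))
    where
    double-+ : ∀ X → X + X ≡ + 2 * X
    double-+ = solve-∀

  edgeGap-nonNeg : ∀ P L X Y θX θY → 0ℤ ≤ P → 0ℤ < X → 0ℤ < Y → X + Y ≤ L →
    Excess L X θX → Excess L Y θY → 0ℤ ≤ edgeGap P L X Y θX θY
  edgeGap-nonNeg P L X Y θX θY hP hX hY h eX eY =
    [ (λ X≤Y → edgeGap-ordered P L X Y θX θY hP (<⇒≤ hX) X≤Y hY h eX eY)
    , (λ Y≤X → subst (0ℤ ≤_) (edgeGap-sym P L Y X θY θX)
        (edgeGap-ordered P L Y X θY θX hP (<⇒≤ hY) Y≤X hX (subst (_≤ L) (+-comm X Y) h) eY eX))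
    ]′ (≤-total X Y)

  -- Sums and counting over Fin n

  sum-mono : ∀ {n} {f g : Fin n → ℤ} → (∀ i → f i ≤ g i) → sum f ≤ sum g
  sum-mono {zero}  h = ≤-refl
  sum-mono {suc n} h = +-mono-≤ (h zero) (sum-mono (h ∘ suc))

  sum-nonNeg : ∀ {n} {f : Fin n → ℤ} → (∀ i → 0ℤ ≤ f i) → 0ℤ ≤ sum f
  sum-nonNeg {zero}  h = ≤-refl
  sum-nonNeg {suc n} h = 0≤+ (h zero) (sum-nonNeg (h ∘ suc))

  sum-≤0⇒≤0 : ∀ {n} {f : Fin n → ℤ} → (∀ i → 0ℤ ≤ f i) → sum f ≤ 0ℤ → ∀ i → f i ≤ 0ℤ
  sum-≤0⇒≤0 {suc n} {f} h le zero =
    ≤-trans (subst (_≤ f zero + sum (f ∘ suc)) (+-identityʳ (f zero)) (+-monoʳ-≤ (f zero) (sum-nonNeg (h ∘ suc)))) le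
  sum-≤0⇒≤0 {suc n} {f} h le (suc i) =
    sum-≤0⇒≤0 (h ∘ suc)
      (≤-trans (subst (_≤ f zero + sum (f ∘ suc)) (+-identityˡ (sum (f ∘ suc))) (+-monoˡ-≤ (sum (f ∘ suc)) (h zero))) le) i

  𝟙 : Bool → ℤ
  𝟙 true  = 1ℤ
  𝟙 false = 0ℤ

  same : Bool → Bool → ℤ
  same a b = 𝟙 (not (a xor b))

  same-sym : ∀ a b → same a b ≡ same b a
  same-sym true  true  = refl
  same-sym true  false = refl
  same-sym false true  = refl
  same-sym false false = refl

  card : ∀ {n} → (Fin n → Bool) → ℕ
  card {zero}  S = 0
  card {suc n} S = (if S zero then suc else (λ m → m)) (card (S ∘ suc))

  card-sum : ∀ {n} (S : Fin n → Bool) → + card S ≡ sum (𝟙 ∘ S)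
  card-sum {zero}  S = refl
  card-sum {suc n} S with S zero
  ... | true  = cong (λ s → 1ℤ + s) (card-sum (S ∘ suc))
  ... | false = trans (card-sum (S ∘ suc)) (sym (+-identityˡ _))

  card-not : ∀ {n} (S : Fin n → Bool) → card S ℕ.+ card (not ∘ S) ≡ n
  card-not {zero}  S = refl
  card-not {suc n} S with S zero
  ... | true  = cong suc (card-not (S ∘ suc))
  ... | false = trans (ℕ.+-suc (card (S ∘ suc)) _) (cong suc (card-not (S ∘ suc)))

  length-filter-tabulate : ∀ {n} {A : Set} {P : Pred A 0ℓ} (P? : Decidable P) (g : Fin n → A) →
    + length (filter P? (tabulate g)) ≡ sum (λ i → 𝟙 (does (P? (g i))))
  length-filter-tabulate {zero}  P? g = refl
  length-filter-tabulate {suc n} P? g with does (P? (g zero))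
  ... | true  = cong (λ s → 1ℤ + s) (length-filter-tabulate P? (g ∘ suc))
  ... | false = trans (length-filter-tabulate P? (g ∘ suc)) (sym (+-identityˡ _))

  length-filter-map-filter-tabulate :
    ∀ {n} {A B : Set} {P : Pred A 0ℓ} {Q : Pred B 0ℓ} (P? : Decidable P) (Q? : Decidable Q)
      (f : A → B) (g : Fin n → A) →
    + length (filter Q? (map f (filter P? (tabulate g))))
      ≡ sum (λ i → 𝟙 (does (P? (g i))) * 𝟙 (does (Q? (f (g i)))))
  length-filter-map-filter-tabulate {zero}  P? Q? f g = refl
  length-filter-map-filter-tabulate {suc n} P? Q? f g with does (P? (g zero))
  ... | false = trans (length-filter-map-filter-tabulate P? Q? f (g ∘ suc)) (sym (+-identityˡ _))
  ... | true with does (Q? (f (g zero)))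
  ...   | true  = cong (λ s → 1ℤ + s) (length-filter-map-filter-tabulate P? Q? f (g ∘ suc))
  ...   | false = trans (length-filter-map-filter-tabulate P? Q? f (g ∘ suc)) (sym (+-identityˡ _))

  length-filter-concatMap-tabulate : ∀ {n} {A B : Set} {P : Pred B 0ℓ} (P? : Decidable P)
    (F : A → List B) (g : Fin n → A) →
    + length (filter P? (concatMap F (tabulate g))) ≡ sum (λ i → + length (filter P? (F (g i))))
  length-filter-concatMap-tabulate {zero}  P? F g = refl
  length-filter-concatMap-tabulate {suc n} P? F g = begin
    + length (filter P? (F (g zero) ++ rest))
      ≡⟨ cong (λ l → + length l) (filter-++ P? (F (g zero)) rest) ⟩
    + length (filter P? (F (g zero)) ++ filter P? rest)
      ≡⟨ cong +_ (length-++ (filter P? (F (g zero)))) ⟩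
    + length (filter P? (F (g zero))) + + length (filter P? rest)
      ≡⟨ cong (λ s → + length (filter P? (F (g zero))) + s) (length-filter-concatMap-tabulate P? F (g ∘ suc)) ⟩
    _ ∎
    where
    open ≡-Reasoning
    rest = concatMap F (tabulate (g ∘ suc))

  does-≟-true : ∀ b → does (Data.Bool._≟_ b true) ≡ b
  does-≟-true true  = refl
  does-≟-true false = refl

  count≡card : ∀ {n} (S : Fin n → Bool) → count S ≡ card S
  count≡card S = +-injective (trans (length-filter-tabulate (λ v → Data.Bool._≟_ (S v) true) (λ i → i))
    (trans (sum-cong-≗ (λ i → cong 𝟙 (does-≟-true (S i)))) (sym (card-sum S))))

  below : ∀ {n} → Fin n → Fin n → ℤ
  below i j = 𝟙 (does (toℕ i ℕ.<? toℕ j))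

  eIn-sum : ∀ {n} (G : Graph n) S →
    + eIn G S ≡ sum (λ i → sum (λ j → below i j * 𝟙 (S i ∧ S j ∧ adj G i j)))
  eIn-sum {n} G S = trans (length-filter-concatMap-tabulate Q? F (λ i → i))
    (sum-cong-≗ (λ i → trans (length-filter-map-filter-tabulate (λ j → toℕ i ℕ.<? toℕ j) Q? (i ,_) (λ j → j))
      (sum-cong-≗ (λ j → cong (λ b → below i j * 𝟙 b) (does-≟-true (S i ∧ S j ∧ adj G i j))))))
    where
    Q? = λ (p : Fin n × Fin n) → Data.Bool._≟_ (S (proj₁ p) ∧ S (proj₂ p) ∧ adj G (proj₁ p) (proj₂ p)) true
    F = λ i → map (i ,_) (filter (λ j → toℕ i ℕ.<? toℕ j) (allFin n))

  below-off-diagonal : ∀ {n} (i j : Fin n) → i ≢ j → below i j + below j i ≡ 1ℤ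
  below-off-diagonal i j i≢j with ℕ.<-cmp (toℕ i) (toℕ j)
  ... | tri< i<j _ j≮i rewrite dec-true (toℕ i ℕ.<? toℕ j) i<j | dec-false (toℕ j ℕ.<? toℕ i) j≮i = refl
  ... | tri> i≮j _ j<i rewrite dec-false (toℕ i ℕ.<? toℕ j) i≮j | dec-true (toℕ j ℕ.<? toℕ i) j<i = refl
  ... | tri≈ _ i≡j _ = contradiction (toℕ-injective i≡j) i≢j

  sum-symmetric : ∀ {n} (q : Fin n → Fin n → ℤ) → (∀ i j → q i j ≡ q j i) → (∀ i → q i i ≡ 0ℤ) →
    + 2 * sum (λ i → sum (λ j → below i j * q i j)) ≡ sum (λ i → sum (q i))
  sum-symmetric q q-sym q-diag = begin
    + 2 * U ≡⟨ two U ⟩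
    U + U
      ≡⟨ cong (λ s → U + s) (trans (∑-comm (λ i j → below i j * q i j))
           (sum-cong-≗ (λ j → sum-cong-≗ (λ i → cong (below i j *_) (q-sym i j))))) ⟩
    U + sum (λ j → sum (λ i → below i j * q j i))
      ≡⟨ sym (∑-distrib-+ (λ i → sum (λ j → below i j * q i j)) (λ i → sum (λ j → below j i * q i j))) ⟩
    sum (λ i → sum (λ j → below i j * q i j) + sum (λ j → below j i * q i j))
      ≡⟨ sum-cong-≗ (λ i → sym (∑-distrib-+ (λ j → below i j * q i j) (λ j → below j i * q i j))) ⟩
    sum (λ i → sum (λ j → below i j * q i j + below j i * q i j))
      ≡⟨ sum-cong-≗ (λ i → sum-cong-≗ (λ j → pointwise i j)) ⟩
    sum (λ i → sum (q i)) ∎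
    where
    open ≡-Reasoning
    U = sum (λ i → sum (λ j → below i j * q i j))
    two : ∀ x → + 2 * x ≡ x + x
    two = solve-∀
    pointwise : ∀ i j → below i j * q i j + below j i * q i j ≡ q i j
    pointwise i j with Data.Fin._≟_ i j
    ... | yes refl rewrite q-diag i = cong₂ _+_ (*-zeroʳ (below i i)) (*-zeroʳ (below i i))
    ... | no i≢j = trans (sym (*-distribʳ-+ (q i j) (below i j) (below j i)))
            (trans (cong (_* q i j) (below-off-diagonal i j i≢j)) (*-identityˡ (q i j)))

  edge : ∀ {n} → Graph n → Fin n → Fin n → ℤ
  edge G u v = 𝟙 (adj G u v)

  -- Ordered pairs see every edge twice. All later sums run over ordered pairs, since these split
  -- into sums over single vertices.
  cost-sum : ∀ {n} (G : Graph n) S →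
    + 2 * + cost G S ≡ sum (λ u → sum (λ v → edge G u v * same (S u) (S v)))
  cost-sum G S = begin
    + 2 * + cost G S
      ≡⟨ cong (+ 2 *_) (cong₂ _+_ (eIn-sum G S) (eIn-sum G (not ∘ S))) ⟩
    + 2 * (sum (λ i → sum (p i)) + sum (λ i → sum (p′ i)))
      ≡⟨ cong (+ 2 *_) (trans (sym (∑-distrib-+ (λ i → sum (p i)) (λ i → sum (p′ i))))
           (sum-cong-≗ (λ i → trans (sym (∑-distrib-+ (p i) (p′ i))) (sum-cong-≗ (pointwise i))))) ⟩
    + 2 * sum (λ i → sum (λ j → below i j * (edge G i j * same (S i) (S j))))
      ≡⟨ sum-symmetric (λ i j → edge G i j * same (S i) (S j))
           (λ i j → cong₂ _*_ (cong 𝟙 (Graph.sym G i j)) (same-sym (S i) (S j)))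
           (λ i → cong (λ b → 𝟙 b * same (S i) (S i)) (irrefl G i)) ⟩
    _ ∎
    where
    open ≡-Reasoning
    p = λ i j → below i j * 𝟙 (S i ∧ S j ∧ adj G i j)
    p′ = λ i j → below i j * 𝟙 (not (S i) ∧ not (S j) ∧ adj G i j)
    split : ∀ a b c → 𝟙 (a ∧ b ∧ c) + 𝟙 (not a ∧ not b ∧ c) ≡ 𝟙 c * same a b
    split true  true  true  = refl
    split true  true  false = refl
    split true  false true  = refl
    split true  false false = refl
    split false true  true  = refl
    split false true  false = refl
    split false false true  = refl
    split false false false = refl
    pointwise : ∀ i j → p i j + p′ i j ≡ below i j * (edge G i j * same (S i) (S j))
    pointwise i j = trans (sym (*-distribˡ-+ (below i j) _ _)) (cong (below i j *_) (split (S i) (S j) (adj G i j)))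

  -- Random partitions

  data Role : Set where
    fixed : Bool → Role
    free  : Role

  frees trues : ∀ {n} → Vec Role n → ℕ
  frees []                = 0
  frees (fixed _ ∷ R)     = frees R
  frees (free ∷ R)        = suc (frees R)
  trues []                = 0
  trues (fixed true ∷ R)  = suc (trues R)
  trues (fixed false ∷ R) = trues R
  trues (free ∷ R)        = trues R

  -- The free vertices are placed one after the other, the true side having k places left and the
  -- false side j; each choice is weighted by the number of places left on the chosen side, so that
  -- all placements filling both sides exactly get the same weight k! j!.
  sample : ∀ {n} → Vec Role n → ℤ → ℤ → ((Fin n → Bool) → ℤ) → ℤ
  sample []            k j f = f []ᶠ
  sample (fixed b ∷ R) k j f = sample R k j (λ S → f (b ∷ᶠ S))
  sample (free ∷ R)    k j f =
    k * sample R (k - 1ℤ) j (λ S → f (true ∷ᶠ S)) + j * sample R k (j - 1ℤ) (λ S → f (false ∷ᶠ S))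

  falling : ℤ → ℕ → ℤ
  falling c zero    = 1ℤ
  falling c (suc r) = c * falling (c - 1ℤ) r

  falling-pos : ∀ r → 0ℤ < falling (+ r) r
  falling-pos zero    = +<+ (s≤s z≤n)
  falling-pos (suc r) = 0<* {+ suc r} {falling (+ r) r} (+<+ (s≤s z≤n)) (falling-pos r)

  sample-cong : ∀ {n} (R : Vec Role n) k j {f g} → (∀ S → f S ≡ g S) → sample R k j f ≡ sample R k j g
  sample-cong []            k j h = h _
  sample-cong (fixed b ∷ R) k j h = sample-cong R k j (λ S → h (b ∷ᶠ S))
  sample-cong (free ∷ R)    k j h = cong₂ _+_
    (cong (k *_) (sample-cong R (k - 1ℤ) j (λ S → h (true ∷ᶠ S))))
    (cong (j *_) (sample-cong R k (j - 1ℤ) (λ S → h (false ∷ᶠ S))))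

  sample-+ : ∀ {n} (R : Vec Role n) k j f g →
    sample R k j (λ S → f S + g S) ≡ sample R k j f + sample R k j g
  sample-+ []            k j f g = refl
  sample-+ (fixed b ∷ R) k j f g = sample-+ R k j (λ S → f (b ∷ᶠ S)) (λ S → g (b ∷ᶠ S))
  sample-+ (free ∷ R)    k j f g
    rewrite sample-+ R (k - 1ℤ) j (λ S → f (true ∷ᶠ S)) (λ S → g (true ∷ᶠ S))
          | sample-+ R k (j - 1ℤ) (λ S → f (false ∷ᶠ S)) (λ S → g (false ∷ᶠ S))
    = identity k j _ _ _ _
    where
    identity : ∀ k j a b c d → k * (a + b) + j * (c + d) ≡ (k * a + j * c) + (k * b + j * d)
    identity = solve-∀

  sample-* : ∀ {n} (R : Vec Role n) k j c f → sample R k j (λ S → c * f S) ≡ c * sample R k j f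
  sample-* []            k j c f = refl
  sample-* (fixed b ∷ R) k j c f = sample-* R k j c (λ S → f (b ∷ᶠ S))
  sample-* (free ∷ R)    k j c f
    rewrite sample-* R (k - 1ℤ) j c (λ S → f (true ∷ᶠ S))
          | sample-* R k (j - 1ℤ) c (λ S → f (false ∷ᶠ S))
    = identity k j c _ _
    where
    identity : ∀ k j c a b → k * (c * a) + j * (c * b) ≡ c * (k * a + j * b)
    identity = solve-∀

  sample-sum : ∀ {m n} (R : Vec Role n) k j (f : Fin m → (Fin n → Bool) → ℤ) →
    sample R k j (λ S → sum (λ i → f i S)) ≡ sum (λ i → sample R k j (f i))
  sample-sum {zero}  R k j f = trans (sample-* R k j 0ℤ (λ _ → 1ℤ)) (*-zeroˡ (sample R k j (λ _ → 1ℤ)))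
  sample-sum {suc m} R k j f =
    trans (sample-+ R k j (f zero) (λ S → sum (λ i → f (suc i) S)))
      (cong (λ s → sample R k j (f zero) + s) (sample-sum R k j (f ∘ suc)))

  -- A side without places has weight 0, which removes the branches where `k - 1ℤ` or `j - 1ℤ` would
  -- be negative. With `frees R ≡ k + j` every surviving leaf has filled both sides exactly, so the
  -- bound on `f` applies there.
  sample-bound : ∀ {n} (R : Vec Role n) k j (D : ℤ) (f : (Fin n → Bool) → ℤ) → frees R ≡ k ℕ.+ j →
    (∀ S → card S ≡ trues R ℕ.+ k → D ≤ f S) → D * sample R (+ k) (+ j) (λ _ → 1ℤ) ≤ sample R (+ k) (+ j) f
  sample-bound [] zero j D f eq h = subst (_≤ f []ᶠ) (sym (*-identityʳ D)) (h []ᶠ refl)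
  sample-bound (fixed true ∷ R) k j D f eq h =
    sample-bound R k j D (λ S → f (true ∷ᶠ S)) eq (λ S e → h (true ∷ᶠ S) (cong suc e))
  sample-bound (fixed false ∷ R) k j D f eq h =
    sample-bound R k j D (λ S → f (false ∷ᶠ S)) eq (λ S e → h (false ∷ᶠ S) e)
  sample-bound (free ∷ R) k j D f eq h =
    subst (_≤ sample (free ∷ R) (+ k) (+ j) f) (sym (identity D (+ k) (+ j) _ _))
      (+-mono-≤ (inTrue k eq h) (inFalse j eq h))
    where
    identity : ∀ D k j a b → D * (k * a + j * b) ≡ k * (D * a) + j * (D * b)
    identity = solve-∀

    inTrue : ∀ k → suc (frees R) ≡ k ℕ.+ j → (∀ S → card S ≡ trues R ℕ.+ k → D ≤ f S) →
      + k * (D * sample R (+ k - 1ℤ) (+ j) (λ _ → 1ℤ)) ≤ + k * sample R (+ k - 1ℤ) (+ j) (λ S → f (true ∷ᶠ S))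
    inTrue zero    eq h = ≤-refl
    inTrue (suc k) eq h = *-monoˡ-≤-nonNeg (+ suc k)
      (sample-bound R k j D (λ S → f (true ∷ᶠ S)) (ℕ.suc-injective eq)
        (λ S e → h (true ∷ᶠ S) (trans (cong suc e) (sym (ℕ.+-suc (trues R) k)))))

    inFalse : ∀ j → suc (frees R) ≡ k ℕ.+ j → (∀ S → card S ≡ trues R ℕ.+ k → D ≤ f S) →
      + j * (D * sample R (+ k) (+ j - 1ℤ) (λ _ → 1ℤ)) ≤ + j * sample R (+ k) (+ j - 1ℤ) (λ S → f (false ∷ᶠ S))
    inFalse zero    eq h = ≤-refl
    inFalse (suc j) eq h = *-monoˡ-≤-nonNeg (+ suc j)
      (sample-bound R k j D (λ S → f (false ∷ᶠ S)) (ℕ.suc-injective (trans eq (ℕ.+-suc k j)))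
        (λ S e → h (false ∷ᶠ S) e))

  -1-+ : ∀ k j → k - 1ℤ + j ≡ k + j - 1ℤ
  -1-+ = solve-∀

  +--1 : ∀ k j → k + (j - 1ℤ) ≡ k + j - 1ℤ
  +--1 = solve-∀

  -- By induction both branches have the same total weight, that of k + j - 1 places, and their
  -- factors k and j add up.
  sample-1 : ∀ {n} (R : Vec Role n) k j → sample R k j (λ _ → 1ℤ) ≡ falling (k + j) (frees R)
  sample-1 []            k j = refl
  sample-1 (fixed b ∷ R) k j = sample-1 R k j
  sample-1 (free ∷ R)    k j
    rewrite sample-1 R (k - 1ℤ) j | sample-1 R k (j - 1ℤ) | -1-+ k j | +--1 k j
    = sym (*-distribʳ-+ (falling (k + j - 1ℤ) (frees R)) k j)

  sample-const : ∀ {n} (R : Vec Role n) k j c → sample R k j (λ _ → c) ≡ c * falling (k + j) (frees R)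
  sample-const R k j c = trans (sample-cong R k j (λ _ → sym (*-identityʳ c)))
    (trans (sample-* R k j c (λ _ → 1ℤ)) (cong (c *_) (sample-1 R k j)))

  free⇒frees>0 : ∀ {n} (R : Vec Role n) u → lookup R u ≡ free → ∃ λ r → frees R ≡ suc r
  free⇒frees>0 (free ∷ R)    u       eq = frees R , refl
  free⇒frees>0 (fixed b ∷ R) (suc u) eq = free⇒frees>0 R u eq

  -- The side of u is a separate argument of `f`, so that one occurrence of `S u` can be replaced
  -- while the rest still depends on S.
  sample-fixed : ∀ {n} (R : Vec Role n) k j u b (f : Bool → (Fin n → Bool) → ℤ) → lookup R u ≡ fixed b →
    sample R k j (λ S → f (S u) S) ≡ sample R k j (f b)
  sample-fixed (fixed b ∷ R) k j zero    b f refl = refl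
  sample-fixed (fixed c ∷ R) k j (suc u) b f eq = sample-fixed R k j u b (λ x S → f x (c ∷ᶠ S)) eq
  sample-fixed (free ∷ R)    k j (suc u) b f eq = cong₂ _+_
    (cong (k *_) (sample-fixed R (k - 1ℤ) j u b (λ x S → f x (true ∷ᶠ S)) eq))
    (cong (j *_) (sample-fixed R k (j - 1ℤ) u b (λ x S → f x (false ∷ᶠ S)) eq))

  places : Bool → ℤ → ℤ → ℤ
  places true  k j = k
  places false k j = j

  -- Probability `places b k j` / (k + j). The free vertices are exchangeable although they are
  -- placed in order: placing another one first does not change this ratio on average.
  sample-side : ∀ {n} (R : Vec Role n) k j u b r → lookup R u ≡ free → frees R ≡ suc r →
    sample R k j (λ S → same b (S u)) ≡ places b k j * falling (k + j - 1ℤ) r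
  sample-side (fixed c ∷ R) k j (suc u) b r eq er = sample-side R k j u b r eq er
  sample-side (free ∷ R) k j zero true r eq refl
    rewrite sample-const R (k - 1ℤ) j 1ℤ | sample-const R k (j - 1ℤ) 0ℤ | -1-+ k j
    = identity k j _
    where
    identity : ∀ k j a → k * (1ℤ * a) + j * 0ℤ ≡ k * a
    identity = solve-∀
  sample-side (free ∷ R) k j zero false r eq refl
    rewrite sample-const R (k - 1ℤ) j 0ℤ | sample-const R k (j - 1ℤ) 1ℤ | +--1 k j
    = identity k j _
    where
    identity : ∀ k j a → k * 0ℤ + j * (1ℤ * a) ≡ j * a
    identity = solve-∀
  sample-side (free ∷ R) k j (suc u) b r eq er with free⇒frees>0 R u eq
  sample-side (free ∷ R) k j (suc u) b r eq refl | r′ , er′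
    rewrite sample-side R (k - 1ℤ) j u b r′ eq er′ | sample-side R k (j - 1ℤ) u b r′ eq er′ | er′
          | -1-+ k j | +--1 k j
    = identity b
    where
    F = falling (k + j - 1ℤ - 1ℤ) r′
    identityᵗ : ∀ k j F → k * ((k - 1ℤ) * F) + j * (k * F) ≡ k * ((k + j - 1ℤ) * F)
    identityᵗ = solve-∀
    identityᶠ : ∀ k j F → k * (j * F) + j * ((j - 1ℤ) * F) ≡ j * ((k + j - 1ℤ) * F)
    identityᶠ = solve-∀
    identity : ∀ b → k * (places b (k - 1ℤ) j * F) + j * (places b k (j - 1ℤ) * F)
      ≡ places b k j * ((k + j - 1ℤ) * F)
    identity true  = identityᵗ k j F
    identity false = identityᶠ k j F

  -- Probability (k (k - 1) + j (j - 1)) / (c (c - 1)) with c = k + j: once the first of the two has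
  -- taken a place, its side has one place fewer for the other. This is less than (k² + j²) / c² by
  -- 2 k j / (c² (c - 1)).
  sample-same : ∀ {n} (R : Vec Role n) k j u v r → u ≢ v → lookup R u ≡ free → lookup R v ≡ free →
    frees R ≡ suc (suc r) →
    sample R k j (λ S → same (S u) (S v)) ≡ (k * (k - 1ℤ) + j * (j - 1ℤ)) * falling (k + j - 1ℤ - 1ℤ) r
  sample-same R k j zero zero r u≢v = ⊥-elim (u≢v refl)
  sample-same (fixed c ∷ R) k j (suc u) (suc v) r u≢v eu ev er =
    sample-same R k j u v r (u≢v ∘ cong suc) eu ev er
  sample-same (free ∷ R) k j zero (suc v) r u≢v eu ev er
    rewrite sample-side R (k - 1ℤ) j v true r ev (ℕ.suc-injective er)
          | sample-side R k (j - 1ℤ) v false r ev (ℕ.suc-injective er)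
          | -1-+ k j | +--1 k j
    = identity k j (falling (k + j - 1ℤ - 1ℤ) r)
    where
    identity : ∀ k j F → k * ((k - 1ℤ) * F) + j * ((j - 1ℤ) * F) ≡ (k * (k - 1ℤ) + j * (j - 1ℤ)) * F
    identity = solve-∀
  sample-same (free ∷ R) k j (suc u) zero r u≢v eu ev er =
    trans (sample-cong (free ∷ R) k j (λ S → same-sym (S (suc u)) (S zero)))
      (sample-same (free ∷ R) k j zero (suc u) r (λ ()) ev eu er)
  sample-same (free ∷ R) k j (suc u) (suc v) r u≢v eu ev er with two R u v (u≢v ∘ cong suc) eu ev
    where
    two : ∀ {n} (R : Vec Role n) u v → u ≢ v → lookup R u ≡ free → lookup R v ≡ free →
      ∃ λ r → frees R ≡ suc (suc r)
    two R zero zero u≢v eu ev = ⊥-elim (u≢v refl)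
    two (free ∷ R) zero (suc v) u≢v eu ev = let r , er = free⇒frees>0 R v ev in r , cong suc er
    two (free ∷ R) (suc u) v u≢v eu ev = let r , er = free⇒frees>0 R u eu in r , cong suc er
    two (fixed c ∷ R) (suc u) (suc v) u≢v eu ev = two R u v (u≢v ∘ cong suc) eu ev
  sample-same (free ∷ R) k j (suc u) (suc v) r u≢v eu ev er | r′ , er′
    with refl ← trans (sym (ℕ.suc-injective er)) er′
    rewrite sample-same R (k - 1ℤ) j u v r′ (u≢v ∘ cong suc) eu ev er′
          | sample-same R k (j - 1ℤ) u v r′ (u≢v ∘ cong suc) eu ev er′
          | -1-+ k j | +--1 k j
    = identity k j (falling (k + j - 1ℤ - 1ℤ - 1ℤ) r′)
    where
    identity : ∀ k j F →
      k * (((k - 1ℤ) * (k - 1ℤ - 1ℤ) + j * (j - 1ℤ)) * F) + j * ((k * (k - 1ℤ) + (j - 1ℤ) * (j - 1ℤ - 1ℤ)) * F)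
        ≡ (k * (k - 1ℤ) + j * (j - 1ℤ)) * ((k + j - 1ℤ - 1ℤ) * F)
    identity = solve-∀

  -- Averaging over balanced partitions

  frees-replicate : ∀ n → frees (replicate n free) ≡ n
  frees-replicate zero    = refl
  frees-replicate (suc n) = cong suc (frees-replicate n)

  trues-replicate : ∀ n → trues (replicate n free) ≡ 0
  trues-replicate zero    = refl
  trues-replicate (suc n) = trues-replicate n

  -- For a vertex w of degree at most h the whole neighbourhood is put on the true side, for one of
  -- larger degree the true side is chosen inside the neighbourhood.
  keepTrue splitTrue : Bool → Role
  keepTrue true   = fixed true
  keepTrue false  = free
  splitTrue true  = free
  splitTrue false = fixed false

  frees-keepTrue : ∀ {n} (ν : Fin n → Bool) → frees (Vec.tabulate (keepTrue ∘ ν)) ≡ card (not ∘ ν)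
  frees-keepTrue {zero}  ν = refl
  frees-keepTrue {suc n} ν with ν zero
  ... | true  = frees-keepTrue (ν ∘ suc)
  ... | false = cong suc (frees-keepTrue (ν ∘ suc))

  trues-keepTrue : ∀ {n} (ν : Fin n → Bool) → trues (Vec.tabulate (keepTrue ∘ ν)) ≡ card ν
  trues-keepTrue {zero}  ν = refl
  trues-keepTrue {suc n} ν with ν zero
  ... | true  = cong suc (trues-keepTrue (ν ∘ suc))
  ... | false = trues-keepTrue (ν ∘ suc)

  frees-splitTrue : ∀ {n} (ν : Fin n → Bool) → frees (Vec.tabulate (splitTrue ∘ ν)) ≡ card ν
  frees-splitTrue {zero}  ν = refl
  frees-splitTrue {suc n} ν with ν zero
  ... | true  = cong suc (frees-splitTrue (ν ∘ suc))
  ... | false = frees-splitTrue (ν ∘ suc)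

  trues-splitTrue : ∀ {n} (ν : Fin n → Bool) → trues (Vec.tabulate (splitTrue ∘ ν)) ≡ 0
  trues-splitTrue {zero}  ν = refl
  trues-splitTrue {suc n} ν with ν zero
  ... | true  = trues-splitTrue (ν ∘ suc)
  ... | false = trues-splitTrue (ν ∘ suc)

  ≤cancelʳ : ∀ {i j k} → 0ℤ < k → i * k ≤ j * k → i ≤ j
  ≤cancelʳ {i} {j} {k} k>0 = *-cancelʳ-≤-pos i j k {{positive k>0}}

  module Degrees {n : ℕ} (G : Graph n) where

    deg : Fin n → ℕ
    deg u = card (adj G u)

    deg₂ : Fin n → ℤ
    deg₂ u = sum (λ v → edge G u v * + deg v)

    E : ℤ
    E = sum (λ u → + deg u)

    edge-sym : ∀ u v → edge G u v ≡ edge G v u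
    edge-sym u v = cong 𝟙 (Graph.sym G u v)

    deg-sum : ∀ u → + deg u ≡ sum (edge G u)
    deg-sum u = card-sum (adj G u)

    sum-edge-left : ∀ (g : Fin n → ℤ) →
      sum (λ u → sum (λ v → edge G u v * g u)) ≡ sum (λ u → + deg u * g u)
    sum-edge-left g = sum-cong-≗ (λ u →
      trans (sym (*-distribʳ-sum (g u) (edge G u))) (cong (_* g u) (sym (deg-sum u))))

    sum-edge-right : ∀ (g : Fin n → ℤ) →
      sum (λ u → sum (λ v → edge G u v * g v)) ≡ sum (λ u → + deg u * g u)
    sum-edge-right g = trans (∑-comm (λ u v → edge G u v * g v))
      (trans (sum-cong-≗ (λ v → sum-cong-≗ (λ u → cong (_* g v) (edge-sym u v)))) (sum-edge-left g))

    sum-deg-edge : ∀ w → sum (λ u → + deg u * edge G w u) ≡ deg₂ w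
    sum-deg-edge w = sum-cong-≗ (λ u → *-comm (+ deg u) (edge G w u))

    -- In a triangle-free graph an edge has at most one end in the neighbourhood of w, so every
    -- quantity determined by the number of such ends has the form A + C · (number). Over all
    -- ordered edges, either end is a neighbour of w `deg₂ w` times.
    sum-neighbour-affine : ∀ w A C →
      sum (λ u → sum (λ v → edge G u v * (A + C * (edge G w u + edge G w v)))) ≡ A * E + C * (+ 2 * deg₂ w)
    sum-neighbour-affine w A C = begin
      sum (λ u → sum (λ v → edge G u v * (A + C * (edge G w u + edge G w v))))
        ≡⟨ sum-cong-≗ (λ u → sum-cong-≗ (λ v → expand A C (edge G u v) (edge G w u) (edge G w v))) ⟩
      sum (λ u → sum (λ v → edge G u v * g u + edge G u v * (C * edge G w v)))
        ≡⟨ trans (sum-cong-≗ (λ u → ∑-distrib-+ (λ v → edge G u v * g u) (λ v → edge G u v * (C * edge G w v))))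
             (∑-distrib-+ (λ u → sum (λ v → edge G u v * g u)) (λ u → sum (λ v → edge G u v * (C * edge G w v)))) ⟩
      sum (λ u → sum (λ v → edge G u v * g u)) + sum (λ u → sum (λ v → edge G u v * (C * edge G w v)))
        ≡⟨ cong₂ _+_ (trans (sum-edge-left g) left) (trans (sum-edge-right (λ v → C * edge G w v)) right) ⟩
      A * E + C * deg₂ w + C * deg₂ w
        ≡⟨ collect (A * E) C (deg₂ w) ⟩
      A * E + C * (+ 2 * deg₂ w) ∎
      where
      open ≡-Reasoning
      g = λ u → A + C * edge G w u
      expand : ∀ A C e x y → e * (A + C * (x + y)) ≡ e * (A + C * x) + e * (C * y)
      expand = solve-∀
      collect : ∀ a C s → a + C * s + C * s ≡ a + C * (+ 2 * s)
      collect = solve-∀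
      swap : ∀ C d x → d * (C * x) ≡ C * (d * x)
      swap = solve-∀
      right : sum (λ u → + deg u * (C * edge G w u)) ≡ C * deg₂ w
      right = trans (sum-cong-≗ (λ u → swap C (+ deg u) (edge G w u)))
        (trans (sym (*-distribˡ-sum C (λ u → + deg u * edge G w u))) (cong (C *_) (sum-deg-edge w)))
      left : sum (λ u → + deg u * g u) ≡ A * E + C * deg₂ w
      left = trans (sum-cong-≗ (λ u → *-distribˡ-+ (+ deg u) A (C * edge G w u)))
        (trans (∑-distrib-+ (λ u → + deg u * A) (λ u → + deg u * (C * edge G w u)))
          (cong₂ _+_ (trans (sym (*-distribʳ-sum A (λ u → + deg u))) (*-comm E A)) right))

  module Averages (h : ℕ) (G : Graph (2 ℕ.* h)) (tf : TriangleFree G)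
    (D : ℕ) (D≤cost : ∀ S → Balanced S → D ℕ.≤ cost G S) where

    open Degrees G public

    -- Twice the number of edges avoiding the neighbourhood of w, as the latter is independent.
    ρ : Fin (2 ℕ.* h) → ℤ
    ρ w = E - + 2 * deg₂ w

    no-triangle : ∀ {w u v} → adj G w u ≡ true → adj G w v ≡ true → adj G u v ≡ true → ∀ {A : Set} → A
    no-triangle {w} {u} {v} wu wv uv = ⊥-elim (tf w u v
      (subst T (sym wu) tt , subst T (sym uv) tt , subst T (sym wv) tt))

    adj-irrefl : ∀ {u v} → adj G u v ≡ true → u ≢ v
    adj-irrefl {u} uv refl = contradiction (trans (sym uv) (irrefl G u)) (λ ())

    2D≤cost : ∀ S → card S ≡ h → + 2 * + D ≤ sum (λ u → sum (λ v → edge G u v * same (S u) (S v)))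
    2D≤cost S eq = subst (+ 2 * + D ≤_) (cost-sum G S)
      (*-monoˡ-≤-nonNeg (+ 2) (+≤+ (D≤cost S balanced)))
      where
      card-not-S : card (not ∘ S) ≡ h
      card-not-S = ℕ.+-cancelˡ-≡ h _ _ (trans (cong (ℕ._+ card (not ∘ S)) (sym eq))
        (trans (card-not S) (cong (h ℕ.+_) (ℕ.+-identityʳ h))))
      balanced : Balanced S
      balanced = trans (count≡card S) (trans eq (sym (trans (count≡card (not ∘ S)) card-not-S)))

    average : ∀ R k j w A C → frees R ≡ k ℕ.+ j → trues R ℕ.+ k ≡ h →
      (∀ u v → adj G u v ≡ true →
        sample R (+ k) (+ j) (λ S → same (S u) (S v)) ≡ A + C * (edge G w u + edge G w v)) →
      + 2 * + D * falling (+ (k ℕ.+ j)) (k ℕ.+ j) ≤ A * E + C * (+ 2 * deg₂ w)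
    average R k j w A C fr tr value = begin
      + 2 * + D * falling (+ (k ℕ.+ j)) (k ℕ.+ j)
        ≡⟨ cong (λ r → + 2 * + D * falling (+ (k ℕ.+ j)) r) (sym fr) ⟩
      + 2 * + D * falling (+ (k ℕ.+ j)) (frees R)
        ≡⟨ cong (+ 2 * + D *_) (sym (sample-1 R (+ k) (+ j))) ⟩
      + 2 * + D * sample R (+ k) (+ j) (λ _ → 1ℤ)
        ≤⟨ sample-bound R k j (+ 2 * + D) _ fr (λ S eq → 2D≤cost S (trans eq tr)) ⟩
      sample R (+ k) (+ j) (λ S → sum (λ u → sum (λ v → edge G u v * same (S u) (S v))))
        ≡⟨ trans (sample-sum R (+ k) (+ j) (λ u S → sum (λ v → edge G u v * same (S u) (S v))))
             (sum-cong-≗ (λ u → trans (sample-sum R (+ k) (+ j) (λ v S → edge G u v * same (S u) (S v)))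
               (sum-cong-≗ (λ v → sample-* R (+ k) (+ j) (edge G u v) (λ S → same (S u) (S v)))))) ⟩
      sum (λ u → sum (λ v → edge G u v * sample R (+ k) (+ j) (λ S → same (S u) (S v))))
        ≡⟨ sum-cong-≗ (λ u → sum-cong-≗ (λ v → pointwise u v (adj G u v) refl)) ⟩
      sum (λ u → sum (λ v → edge G u v * (A + C * (edge G w u + edge G w v))))
        ≡⟨ sum-neighbour-affine w A C ⟩
      A * E + C * (+ 2 * deg₂ w) ∎
      where
      open ≤-Reasoning
      pointwise : ∀ u v b → adj G u v ≡ b →
        𝟙 (adj G u v) * sample R (+ k) (+ j) (λ S → same (S u) (S v))
          ≡ 𝟙 (adj G u v) * (A + C * (edge G w u + edge G w v))
      pointwise u v true  e = cong (𝟙 (adj G u v) *_) (value u v e)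
      pointwise u v false e rewrite e = refl


    pairsOn : ℤ → ℤ → ℤ
    pairsOn k j = k * (k - 1ℤ) + j * (j - 1ℤ)

    falling-2-pos : ∀ {c r} → c ≡ suc (suc r) → 0ℤ < falling (+ c - 1ℤ - 1ℤ) r
    falling-2-pos {r = r} refl = falling-pos r

    falling-1-pos : ∀ {c r} → c ≡ suc r → 0ℤ < falling (+ c - 1ℤ) r
    falling-1-pos {r = r} refl = falling-pos r

    random-bound : ∀ (w : Fin (2 ℕ.* h)) r → h ℕ.+ h ≡ suc (suc r) →
      + 2 * + D * (+ (h ℕ.+ h) * (+ (h ℕ.+ h) - 1ℤ)) ≤ pairsOn (+ h) (+ h) * E
    random-bound w r er = ≤cancelʳ (falling-2-pos er) (begin
      + 2 * + D * (c * (c - 1ℤ)) * Φ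
        ≡⟨ assoc (+ 2 * + D) c (c - 1ℤ) Φ ⟩
      + 2 * + D * falling c (suc (suc r))
        ≡⟨ cong (λ m → + 2 * + D * falling c m) (sym er) ⟩
      + 2 * + D * falling c (h ℕ.+ h)
        ≤⟨ average R h h w (q * Φ) 0ℤ fr (cong (ℕ._+ h) (trues-replicate (2 ℕ.* h))) value ⟩
      q * Φ * E + 0ℤ
        ≡⟨ shuffle q Φ E ⟩
      q * E * Φ ∎)
      where
      open ≤-Reasoning
      R = replicate (2 ℕ.* h) free
      c = + (h ℕ.+ h)
      q = pairsOn (+ h) (+ h)
      Φ = falling (c - 1ℤ - 1ℤ) r
      fr : frees R ≡ h ℕ.+ h
      fr = trans (frees-replicate (2 ℕ.* h)) (cong (h ℕ.+_) (ℕ.+-identityʳ h))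
      assoc : ∀ D a b Φ → D * (a * b) * Φ ≡ D * (a * (b * Φ))
      assoc = solve-∀
      shuffle : ∀ q Φ E → q * Φ * E + 0ℤ ≡ q * E * Φ
      shuffle = solve-∀
      value : ∀ u v → adj G u v ≡ true →
        sample R (+ h) (+ h) (λ S → same (S u) (S v)) ≡ q * Φ + 0ℤ * (edge G w u + edge G w v)
      value u v uv = trans
        (sample-same R (+ h) (+ h) u v r (adj-irrefl uv) (lookup-replicate u free) (lookup-replicate v free)
          (trans fr er))
        (sym (+-identityʳ (q * Φ)))

    -- With the neighbourhood on the true side, k true and h false places remain. Put c = k + h. An
    -- edge with one end in the neighbourhood stays inside a side with probability k / c, an edge
    -- avoiding it with probability `pairsOn` / (c (c - 1)).
    low-bound : ∀ w k r → deg w ℕ.+ k ≡ h → k ℕ.+ h ≡ suc (suc r) →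
      + 2 * + D * (+ (k ℕ.+ h) * (+ (k ℕ.+ h) - 1ℤ))
        ≤ pairsOn (+ k) (+ h) * E + (+ k * (+ (k ℕ.+ h) - 1ℤ) - pairsOn (+ k) (+ h)) * (+ 2 * deg₂ w)
    low-bound w k r ek er = ≤cancelʳ (falling-2-pos er) (begin
      + 2 * + D * (c * (c - 1ℤ)) * Φ
        ≡⟨ assoc (+ 2 * + D) c (c - 1ℤ) Φ ⟩
      + 2 * + D * falling c (suc (suc r))
        ≡⟨ cong (λ m → + 2 * + D * falling c m) (sym er) ⟩
      + 2 * + D * falling c (k ℕ.+ h)
        ≤⟨ average R k h w (q * Φ) (C * Φ) fr (trans (cong (ℕ._+ k) (trues-keepTrue (adj G w))) ek)
             (λ u v uv → value u v _ _ refl refl uv) ⟩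
      q * Φ * E + C * Φ * (+ 2 * deg₂ w)
        ≡⟨ shuffle q Φ E C (+ 2 * deg₂ w) ⟩
      (q * E + C * (+ 2 * deg₂ w)) * Φ ∎)
      where
      open ≤-Reasoning
      R = Vec.tabulate (keepTrue ∘ adj G w)
      c = + (k ℕ.+ h)
      q = pairsOn (+ k) (+ h)
      C = + k * (c - 1ℤ) - q
      Φ = falling (c - 1ℤ - 1ℤ) r
      fr : frees R ≡ k ℕ.+ h
      fr = trans (frees-keepTrue (adj G w)) (ℕ.+-cancelˡ-≡ (deg w) _ _
        (trans (card-not (adj G w))
          (trans (cong (h ℕ.+_) (ℕ.+-identityʳ h))
            (trans (cong (ℕ._+ h) (sym ek)) (ℕ.+-assoc (deg w) k h)))))
      role : ∀ u b → adj G w u ≡ b → lookup R u ≡ keepTrue b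
      role u b e = trans (lookup∘tabulate (keepTrue ∘ adj G w) u) (cong keepTrue e)
      assoc : ∀ D a b Φ → D * (a * b) * Φ ≡ D * (a * (b * Φ))
      assoc = solve-∀
      shuffle : ∀ q Φ E C s → q * Φ * E + C * Φ * s ≡ (q * E + C * s) * Φ
      shuffle = solve-∀
      neither : ∀ q Φ C → q * Φ ≡ q * Φ + C * Φ * (0ℤ + 0ℤ)
      neither = solve-∀
      one : ∀ q Φ k c → k * ((c - 1ℤ) * Φ) ≡ q * Φ + (k * (c - 1ℤ) - q) * Φ * 1ℤ
      one = solve-∀
      mixed : ∀ u v → adj G w u ≡ true → adj G w v ≡ false →
        sample R (+ k) (+ h) (λ S → same (S u) (S v)) ≡ q * Φ + C * Φ * 1ℤ
      mixed u v wu wv = trans (sample-fixed R (+ k) (+ h) u true (λ x S → same x (S v)) (role u true wu))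
        (trans (sample-side R (+ k) (+ h) v true (suc r) (role v false wv) (trans fr er)) (one q Φ (+ k) c))
      value : ∀ u v b b′ → adj G w u ≡ b → adj G w v ≡ b′ → adj G u v ≡ true →
        sample R (+ k) (+ h) (λ S → same (S u) (S v)) ≡ q * Φ + C * Φ * (𝟙 b + 𝟙 b′)
      value u v true  true  wu wv uv = no-triangle wu wv uv
      value u v true  false wu wv uv = mixed u v wu wv
      value u v false true  wu wv uv =
        trans (sample-cong R (+ k) (+ h) (λ S → same-sym (S u) (S v))) (mixed v u wv wu)
      value u v false false wu wv uv = trans
        (sample-same R (+ k) (+ h) u v r (adj-irrefl uv) (role u false wu) (role v false wv) (trans fr er))
        (neither q Φ C)

    -- All non-neighbours and j of the h + j neighbours form the false side. Edges avoiding the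
    -- neighbourhood always lie inside that side, the others with probability j / (h + j).
    high-bound : ∀ w j r → h ℕ.+ j ≡ deg w → h ℕ.+ j ≡ suc r →
      + 2 * + D * + (h ℕ.+ j) ≤ + (h ℕ.+ j) * E + (+ j - + (h ℕ.+ j)) * (+ 2 * deg₂ w)
    high-bound w j r ej er = ≤cancelʳ (falling-1-pos er) (begin
      + 2 * + D * c * Φ
        ≡⟨ *-assoc (+ 2 * + D) c Φ ⟩
      + 2 * + D * falling c (suc r)
        ≡⟨ cong (λ m → + 2 * + D * falling c m) (sym er) ⟩
      + 2 * + D * falling c (h ℕ.+ j)
        ≤⟨ average R h j w (c * Φ) (C * Φ) fr (cong (ℕ._+ h) (trues-splitTrue (adj G w)))
             (λ u v uv → value u v _ _ refl refl uv) ⟩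
      c * Φ * E + C * Φ * (+ 2 * deg₂ w)
        ≡⟨ shuffle c Φ E C (+ 2 * deg₂ w) ⟩
      (c * E + C * (+ 2 * deg₂ w)) * Φ ∎)
      where
      open ≤-Reasoning
      R = Vec.tabulate (splitTrue ∘ adj G w)
      c = + (h ℕ.+ j)
      C = + j - c
      Φ = falling (c - 1ℤ) r
      fr : frees R ≡ h ℕ.+ j
      fr = trans (frees-splitTrue (adj G w)) (sym ej)
      role : ∀ u b → adj G w u ≡ b → lookup R u ≡ splitTrue b
      role u b e = trans (lookup∘tabulate (splitTrue ∘ adj G w) u) (cong splitTrue e)
      shuffle : ∀ q Φ E C s → q * Φ * E + C * Φ * s ≡ (q * E + C * s) * Φ
      shuffle = solve-∀
      neither : ∀ c Φ C → 1ℤ * (c * Φ) ≡ c * Φ + C * Φ * (0ℤ + 0ℤ)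
      neither = solve-∀
      one : ∀ c Φ j → j * Φ ≡ c * Φ + (j - c) * Φ * 1ℤ
      one = solve-∀
      mixed : ∀ u v → adj G w u ≡ false → adj G w v ≡ true →
        sample R (+ h) (+ j) (λ S → same (S u) (S v)) ≡ c * Φ + C * Φ * 1ℤ
      mixed u v wu wv = trans (sample-fixed R (+ h) (+ j) u false (λ x S → same x (S v)) (role u false wu))
        (trans (sample-side R (+ h) (+ j) v false r (role v true wv) (trans fr er)) (one c Φ (+ j)))
      value : ∀ u v b b′ → adj G w u ≡ b → adj G w v ≡ b′ → adj G u v ≡ true →
        sample R (+ h) (+ j) (λ S → same (S u) (S v)) ≡ c * Φ + C * Φ * (𝟙 b + 𝟙 b′)
      value u v true  true  wu wv uv = no-triangle wu wv uv
      value u v false true  wu wv uv = mixed u v wu wv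
      value u v true  false wu wv uv =
        trans (sample-cong R (+ h) (+ j) (λ S → same-sym (S u) (S v))) (mixed v u wv wu)
      value u v false false wu wv uv = begin-equality
        sample R (+ h) (+ j) (λ S → same (S u) (S v))
          ≡⟨ sample-fixed R (+ h) (+ j) u false (λ x S → same x (S v)) (role u false wu) ⟩
        sample R (+ h) (+ j) (λ S → same false (S v))
          ≡⟨ sample-fixed R (+ h) (+ j) v false (λ x S → same false x) (role v false wv) ⟩
        sample R (+ h) (+ j) (λ S → 1ℤ)
          ≡⟨ sample-const R (+ h) (+ j) 1ℤ ⟩
        1ℤ * falling c (frees R)
          ≡⟨ cong (λ m → 1ℤ * falling c m) (trans fr er) ⟩
        1ℤ * (c * Φ)
          ≡⟨ neither c Φ C ⟩
        c * Φ + C * Φ * (0ℤ + 0ℤ) ∎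

  -- Summing over the edges

  sum-const : ∀ n c → sum {n} (λ _ → c) ≡ + n * c
  sum-const zero    c = sym (*-zeroˡ c)
  sum-const (suc n) c = trans (cong (λ s → c + s) (sum-const n c)) (sym (suc-* (+ n) c))

  card-disjoint : ∀ {n} (S R : Fin n → Bool) → (∀ i → S i ≡ true → R i ≡ true → ⊥) → card S ℕ.+ card R ℕ.≤ n
  card-disjoint {zero}  S R disj = z≤n
  card-disjoint {suc n} S R disj with S zero in s₀ | R zero in r₀
  ... | true  | true  = ⊥-elim (disj zero s₀ r₀)
  ... | true  | false = s≤s (card-disjoint (S ∘ suc) (R ∘ suc) (disj ∘ suc))
  ... | false | true  = ℕ.≤-trans (ℕ.≤-reflexive (ℕ.+-suc (card (S ∘ suc)) _))
                          (s≤s (card-disjoint (S ∘ suc) (R ∘ suc) (disj ∘ suc)))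
  ... | false | false = ℕ.m≤n⇒m≤1+n (card-disjoint (S ∘ suc) (R ∘ suc) (disj ∘ suc))

  -- An integral substitute for N ! / d, with value 0 at d = 0.
  N!/ : ℕ → ℕ → ℤ
  N!/ N zero    = 0ℤ
  N!/ N (suc d) = + (N ! ℕ./ suc d)

  0≤N!/ : ∀ N d → 0ℤ ≤ N!/ N d
  0≤N!/ N zero    = +≤+ z≤n
  0≤N!/ N (suc d) = +≤+ z≤n

  d*N!/d : ∀ N d → d ℕ.≤ N → d ≢ 0 → + d * N!/ N d ≡ + (N !)
  d*N!/d N zero    _   d≢0 = contradiction refl d≢0
  d*N!/d N (suc d) d≤N _   = trans (sym (pos-* (suc d) (N ! ℕ./ suc d)))
    (cong +_ (m*[n/m]≡n (∣-trans (m∣m*n (d !)) (m≤n⇒m!∣n! d≤N))))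

  -- What the averaging bounds give for 4 D = H², for low (θ = H - d) and high (θ = 0) degrees d alike.
  slack : (H E s d θ : ℤ) → ℤ
  slack H E s d θ = (+ 2 * E - H * H) * (d * d) + + 4 * H * (E - H * H) * θ - + 4 * H * s * d

  -- With c = K + H, the slack is 2 c² times what the bound would read for draws with replacement
  -- and 4 D = H². The true probability is smaller by 2 K H / (c² (c - 1)) on each of the E - 2 s
  -- ordered edges avoiding the neighbourhood, which produces the left-hand side.
  low-slack : ∀ H K E s D →
    + 2 * D * ((K + H) * (K + H - 1ℤ))
      ≤ (K * (K - 1ℤ) + H * (H - 1ℤ)) * E + (K * (K + H - 1ℤ) - (K * (K - 1ℤ) + H * (H - 1ℤ))) * (+ 2 * s) →
    H * H ≤ + 4 * D → 0ℤ ≤ K + H → 0ℤ ≤ K + H - 1ℤ →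
    + 4 * K * H * (E - + 2 * s) ≤ (K + H - 1ℤ) * slack H E s (H - K) K
  low-slack H K E s D bound hD c≥0 c-1≥0 = 0≤i-j⇒j≤i (subst (0ℤ ≤_) (identity H K E s D)
    (0≤+ (0≤* (0≤* {+ 2} {K + H} (+≤+ z≤n) c≥0) (i≤j⇒0≤j-i bound))
         (0≤* (i≤j⇒0≤j-i hD) (0≤* (0≤i*i (K + H)) c-1≥0))))
    where
    identity : ∀ H K E s D →
      + 2 * (K + H) * ((K * (K - 1ℤ) + H * (H - 1ℤ)) * E
        + (K * (K + H - 1ℤ) - (K * (K - 1ℤ) + H * (H - 1ℤ))) * (+ 2 * s)
        - + 2 * D * ((K + H) * (K + H - 1ℤ)))
      + (+ 4 * D - H * H) * ((K + H) * (K + H) * (K + H - 1ℤ))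
      ≡ (K + H - 1ℤ) * ((+ 2 * E - H * H) * ((H - K) * (H - K)) + + 4 * H * (E - H * H) * K - + 4 * H * s * (H - K))
        - + 4 * K * H * (E - + 2 * s)
    identity = solve-∀

  high-slack : ∀ H J E s D → + 2 * D * (H + J) ≤ (H + J) * E + (J - (H + J)) * (+ 2 * s) →
    H * H ≤ + 4 * D → 0ℤ ≤ H + J → 0ℤ ≤ slack H E s (H + J) 0ℤ
  high-slack H J E s D bound hD d≥0 = subst (0ℤ ≤_) (identity H J E s D)
    (0≤+ (0≤* (0≤* {+ 2} {H + J} (+≤+ z≤n) d≥0) (i≤j⇒0≤j-i bound))
         (0≤* (i≤j⇒0≤j-i hD) (0≤i*i (H + J))))
    where
    identity : ∀ H J E s D →
      + 2 * (H + J) * ((H + J) * E + (J - (H + J)) * (+ 2 * s) - + 2 * D * (H + J))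
      + (+ 4 * D - H * H) * ((H + J) * (H + J))
      ≡ (+ 2 * E - H * H) * ((H + J) * (H + J)) + + 4 * H * (E - H * H) * 0ℤ - + 4 * H * s * (H + J)
    identity = solve-∀

  -- Two vertices share a side with probability (H - 1) / (2 H - 1) < 1/2, so H² / 2 ≤ 2 D < E / 2.
  random-slack : ∀ H E D → + 2 * D * ((H + H) * (H + H - 1ℤ)) ≤ (H * (H - 1ℤ) + H * (H - 1ℤ)) * E →
    H * H ≤ + 4 * D → 1ℤ ≤ H → H * H < E
  random-slack H E D bound hD H≥1 = 0<i-j⇒j<i (*-cancelˡ-<-nonNeg (+ 2 * (H - 1ℤ))
      {{nonNegative (0≤* {+ 2} (+≤+ z≤n) (i≤j⇒0≤j-i H≥1))}}
      (subst (_< + 2 * (H - 1ℤ) * (E - H * H)) (sym (*-zeroʳ (+ 2 * (H - 1ℤ))))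
        (<-≤-trans (0<* H>0 H>0) (0≤i-j⇒j≤i
          (0≤cancel {+ 2 * H} (0<* {+ 2} (+<+ (s≤s z≤n)) H>0) (subst (0ℤ ≤_) (identity H E D)
            (0≤+ (0≤* {+ 2} (+≤+ z≤n) (i≤j⇒0≤j-i bound))
                 (0≤* (i≤j⇒0≤j-i hD) (0≤* (0≤+ H≥0 H≥0) 2H-1≥0)))))))))
    where
    H>0 : 0ℤ < H
    H>0 = <-≤-trans (+<+ (s≤s z≤n)) H≥1
    H≥0 = <⇒≤ H>0
    0<i-j⇒j<i : ∀ {i j} → 0ℤ < i - j → j < i
    0<i-j⇒j<i {i} {j} h = subst₂ _<_ (+-identityˡ j) (cancel i j) (+-monoˡ-< j h)
      where
      cancel : ∀ i j → i - j + j ≡ i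
      cancel = solve-∀
    2H-1≥0 : 0ℤ ≤ H + H - 1ℤ
    2H-1≥0 = subst (0ℤ ≤_) (sym (+-assoc H H (- 1ℤ))) (0≤+ H≥0 (i≤j⇒0≤j-i H≥1))
    identity : ∀ H E D →
      + 2 * ((H * (H - 1ℤ) + H * (H - 1ℤ)) * E - + 2 * D * ((H + H) * (H + H - 1ℤ)))
      + (+ 4 * D - H * H) * ((H + H) * (H + H - 1ℤ))
      ≡ + 2 * H * (+ 2 * (H - 1ℤ) * (E - H * H) - H * H)
    identity = solve-∀

  -- In vertexTerm and weightedGap, a and b stand for W / x and W / y.
  vertexTerm : (N E W x a θ : ℤ) → ℤ
  vertexTerm N E W x a θ = E * Λ E (N * N) * a - (+ 8 * E - N * N) * (N * N) * W * x
    - + 2 * (+ 4 * E - N * N) * (N * N * N) * θ * a - Λ E (N * N) * N * W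

  weightedGap : (N E W x y a b θx θy : ℤ) → ℤ
  weightedGap N E W x y a b θx θy =
    + 16 * (N * N * N) * W * (x * y) + vertexTerm N E W x a θx + vertexTerm N E W y b θy

  -- This is `edgeGap` times a b. As x a = y b = W, this multiplication stands for the division by x
  -- y, and the positive factor N W cancels.
  weightedGap-nonNeg : ∀ N E W x y a b θx θy → 0ℤ < N → 0ℤ < W → 0ℤ ≤ a → 0ℤ ≤ b → x * a ≡ W → y * b ≡ W →
    0ℤ ≤ edgeGap E (N * N) (N * x) (N * y) (N * (+ 2 * θx)) (N * (+ 2 * θy)) →
    0ℤ ≤ weightedGap N E W x y a b θx θy
  weightedGap-nonNeg N E W x y a b θx θy N>0 W>0 a≥0 b≥0 xa yb gap =
    0≤cancel {N * W} (0<* N>0 W>0) (subst (0ℤ ≤_)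
      (trans (factor N E (Λ E (N * N)) x y a b θx θy)
        (trans (cong₂ scaled xa yb) (unscale N E (Λ E (N * N)) W x y a b θx θy)))
      (0≤* gap (0≤* a≥0 b≥0)))
    where
    scaled : ℤ → ℤ → ℤ
    scaled V W = N * (+ 16 * (N * N * N) * V * W * (x * y) + E * Λ E (N * N) * (V * b + W * a)
      - (+ 8 * E - N * N) * (N * N) * V * W * (x + y)
      - + 2 * (+ 4 * E - N * N) * (N * N * N) * (W * θx * a + V * θy * b)
      - + 2 * Λ E (N * N) * N * V * W)

    factor : ∀ N E Λ x y a b θx θy →
      (+ 16 * (N * x) * (N * x) * (N * y) * (N * y) + E * Λ * (N * x + N * y)
        - ((+ 8 * E - N * N) * (N * x) * (N * y) * (N * x + N * y)
           + (+ 4 * E - N * N) * (N * N) * (N * y * (N * (+ 2 * θx)) + N * x * (N * (+ 2 * θy)))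
           + + 2 * Λ * (N * x) * (N * y))) * (a * b)
      ≡ N * (+ 16 * (N * N * N) * (x * a) * (y * b) * (x * y) + E * Λ * ((x * a) * b + (y * b) * a)
        - (+ 8 * E - N * N) * (N * N) * (x * a) * (y * b) * (x + y)
        - + 2 * (+ 4 * E - N * N) * (N * N * N) * ((y * b) * θx * a + (x * a) * θy * b)
        - + 2 * Λ * N * (x * a) * (y * b))
    factor = solve-∀

    unscale : ∀ N E Λ W x y a b θx θy →
      N * (+ 16 * (N * N * N) * W * W * (x * y) + E * Λ * (W * b + W * a)
        - (+ 8 * E - N * N) * (N * N) * W * W * (x + y)
        - + 2 * (+ 4 * E - N * N) * (N * N * N) * (W * θx * a + W * θy * b)
        - + 2 * Λ * N * W * W)
      ≡ N * W * (+ 16 * (N * N * N) * W * (x * y)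
        + (E * Λ * a - (+ 8 * E - N * N) * (N * N) * W * x - + 2 * (+ 4 * E - N * N) * (N * N * N) * θx * a - Λ * N * W)
        + (E * Λ * b - (+ 8 * E - N * N) * (N * N) * W * y - + 2 * (+ 4 * E - N * N) * (N * N * N) * θy * b - Λ * N * W))
    unscale = solve-∀

  -- The share of one vertex in the sum over ordered edges: it is an end 2 x times, and its products
  -- with the degrees of its neighbours add up to x s. Everything is divisible by W = x a.
  vertex-identity : ∀ H E W s x a θ → x * a ≡ W →
    + 16 * (+ 2 * H * (+ 2 * H) * (+ 2 * H)) * W * (x * s) + + 2 * (x * vertexTerm (+ 2 * H) E W x a θ)
      ≡ W * (+ 2 * E * Λ E (+ 2 * H * (+ 2 * H)) + - (+ 4 * Λ E (+ 2 * H * (+ 2 * H)) * H) * x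
          + - (+ 32 * H * H) * slack H E s x θ)
  vertex-identity H E W s x a θ refl = identity H E (Λ E (+ 2 * H * (+ 2 * H))) s x a θ
    where
    identity : ∀ H E Λ s x a θ →
      + 16 * (+ 2 * H * (+ 2 * H) * (+ 2 * H)) * (x * a) * (x * s)
      + + 2 * (x * (E * Λ * a - (+ 8 * E - + 2 * H * (+ 2 * H)) * (+ 2 * H * (+ 2 * H)) * (x * a) * x
          - + 2 * (+ 4 * E - + 2 * H * (+ 2 * H)) * (+ 2 * H * (+ 2 * H) * (+ 2 * H)) * θ * a - Λ * (+ 2 * H) * (x * a)))
      ≡ (x * a) * (+ 2 * E * Λ + - (+ 4 * Λ * H) * x
          + - (+ 32 * H * H) * ((+ 2 * E - H * H) * (x * x) + + 4 * H * (E - H * H) * θ - + 4 * H * s * x))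
    identity = solve-∀

  -- For an isolated vertex the vertex identity becomes an inequality, since
  -- p Λ ≥ 4 p − 1 for p = E / N² ≥ 0.
  isolated-bound : ∀ H E W s → 0ℤ ≤ W → 0ℤ ≤ E → 0ℤ ≤ H →
    0ℤ ≤ W * (+ 2 * E * Λ E (+ 2 * H * (+ 2 * H)) + - (+ 4 * Λ E (+ 2 * H * (+ 2 * H)) * H) * 0ℤ
          + - (+ 32 * H * H) * slack H E s 0ℤ H)
  isolated-bound H E W s W≥0 E≥0 H≥0 = 0≤* W≥0 (0≤cancel {+ 13} (+<+ (s≤s z≤n))
    (subst (0ℤ ≤_) (identity H E s)
      (0≤+ (0≤* (0≤* {+ 208} {E * E} (+≤+ z≤n) (0≤* E≥0 E≥0)) E≥0)
        (0≤* {+ 2 * (H * H)} (0≤* {+ 2} (+≤+ z≤n) (0≤i*i H))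
          (0≤+ (0≤* {+ 4} (+≤+ z≤n) (0≤i*i (+ 13 * E - + 14 * (H * H)))) (0≤* {+ 48} (+≤+ z≤n) (0≤i*i (H * H))))))))
    where
    identity : ∀ H E s → + 208 * (E * E) * E
        + + 2 * (H * H) * (+ 4 * ((+ 13 * E - + 14 * (H * H)) * (+ 13 * E - + 14 * (H * H))) + + 48 * (H * H * (H * H)))
      ≡ + 13 * (+ 2 * E * (+ 8 * E * E + + 13 * E * (+ 2 * H * (+ 2 * H)) - + 3 * (+ 2 * H * (+ 2 * H)) * (+ 2 * H * (+ 2 * H)))
          + - (+ 4 * (+ 8 * E * E + + 13 * E * (+ 2 * H * (+ 2 * H)) - + 3 * (+ 2 * H * (+ 2 * H)) * (+ 2 * H * (+ 2 * H))) * H) * 0ℤ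
          + - (+ 32 * H * H) * ((+ 2 * E - H * H) * (0ℤ * 0ℤ) + + 4 * H * (E - H * H) * H - + 4 * H * s * 0ℤ))
    identity = solve-∀

  module Extremal (h : ℕ) (h≥2 : 2 ℕ.≤ h) (G : Graph (2 ℕ.* h)) (tf : TriangleFree G)
    (D : ℕ) (D≤cost : ∀ S → Balanced S → D ℕ.≤ cost G S) (h²≤4D : h ℕ.* h ℕ.≤ 4 ℕ.* D) where

    open Averages h G tf D D≤cost public

    H : ℤ
    H = + h

    H≥1 : 1ℤ ≤ H
    H≥1 = +≤+ (ℕ.≤-trans (s≤s z≤n) h≥2)

    H≥0 : 0ℤ ≤ H
    H≥0 = +≤+ z≤n

    H>0 : 0ℤ < H
    H>0 = <-≤-trans (+<+ (s≤s z≤n)) H≥1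

    H²≤4D : H * H ≤ + 4 * + D
    H²≤4D = subst₂ _≤_ (pos-* h h) (pos-* 4 D) (+≤+ h²≤4D)

    N : ℤ
    N = + 2 * H

    N≡n : N ≡ + (2 ℕ.* h)
    N≡n = sym (pos-* 2 h)

    two-more : ∀ k → ∃ λ r → k ℕ.+ h ≡ suc (suc r)
    two-more k = k ℕ.+ h ℕ.∸ 2 , sym (ℕ.m+[n∸m]≡n (ℕ.≤-trans h≥2 (ℕ.m≤n+m h k)))

    w₀ : Fin (2 ℕ.* h)
    w₀ = fromℕ< (ℕ.≤-trans (ℕ.≤-trans (s≤s z≤n) h≥2) (ℕ.m≤m+n h (h ℕ.+ 0)))

    H²<E : H * H < E
    H²<E = random-slack H E (+ D) (random-bound w₀ (proj₁ (two-more h)) (proj₂ (two-more h))) H²≤4D H≥1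

    E≥0 : 0ℤ ≤ E
    E≥0 = ≤-trans (0≤i*i H) (<⇒≤ H²<E)

    adj⇒deg+deg≤n : ∀ u v → adj G u v ≡ true → deg u ℕ.+ deg v ℕ.≤ 2 ℕ.* h
    adj⇒deg+deg≤n u v uv = card-disjoint (adj G u) (adj G v) (λ i ui vi → no-triangle ui uv (trans (Graph.sym G i v) vi))

    -- The factor is 1 minus the number of ends in the neighbourhood of w. It is never negative at
    -- an edge, as two such ends would close a triangle.
    outside : ∀ w u v → edge G u v * (1ℤ + - 1ℤ * (edge G w u + edge G w v)) ≥ 0ℤ
    outside w u v = go _ _ _ refl refl refl
      where
      go : ∀ a b c → adj G u v ≡ a → adj G w u ≡ b → adj G w v ≡ c → 𝟙 a * (1ℤ + - 1ℤ * (𝟙 b + 𝟙 c)) ≥ 0ℤ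
      go false b     c     uv wu wv = +≤+ z≤n
      go true  true  true  uv wu wv = no-triangle wu wv uv
      go true  true  false uv wu wv = +≤+ z≤n
      go true  false true  uv wu wv = +≤+ z≤n
      go true  false false uv wu wv = +≤+ z≤n

    ρ-sum : ∀ w → sum (λ u → sum (λ v → edge G u v * (1ℤ + - 1ℤ * (edge G w u + edge G w v)))) ≡ ρ w
    ρ-sum w = trans (sum-neighbour-affine w 1ℤ (- 1ℤ)) (simplify E (deg₂ w))
      where
      simplify : ∀ E s → 1ℤ * E + - 1ℤ * (+ 2 * s) ≡ E - + 2 * s
      simplify = solve-∀

    ρ≥0 : ∀ w → 0ℤ ≤ ρ w
    ρ≥0 w = subst (0ℤ ≤_) (ρ-sum w) (sum-nonNeg (λ u → sum-nonNeg (outside w u)))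

    ρ≤0⇒independent : ∀ w → ρ w ≤ 0ℤ → ∀ u v → adj G w u ≡ false → adj G w v ≡ false → adj G u v ≡ false
    ρ≤0⇒independent w h u v wu wv with adj G u v in uv
    ... | false = refl
    ... | true  = ⊥-elim (<⇒≱ (+<+ (s≤s z≤n)) (subst (_≤ 0ℤ) value
        (sum-≤0⇒≤0 (outside w u) (sum-≤0⇒≤0 (λ u → sum-nonNeg (outside w u)) (subst (_≤ 0ℤ) (sym (ρ-sum w)) h) u) v)))
      where
      value : edge G u v * (1ℤ + - 1ℤ * (edge G w u + edge G w v)) ≡ 1ℤ
      value rewrite uv | wu | wv = refl

    θ : Fin (2 ℕ.* h) → ℕ
    θ u = h ℕ.∸ deg u

    σ : Fin (2 ℕ.* h) → ℤ
    σ u = slack H E (deg₂ u) (+ deg u) (+ θ u)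

    +θ : ∀ {d} → d ℕ.≤ h → H - + (h ℕ.∸ d) ≡ + d
    +θ {d} d≤h = trans (cong (λ x → + x - + (h ℕ.∸ d)) (sym (ℕ.m+[n∸m]≡n d≤h)))
      (cancel (+ d) (+ (h ℕ.∸ d)))
      where
      cancel : ∀ d k → d + k - k ≡ d
      cancel = solve-∀

    c-1>0 : ∀ w → 0ℤ < + θ w + H - 1ℤ
    c-1>0 w = subst (λ c → 0ℤ < + c - 1ℤ) (sym (proj₂ (two-more (θ w)))) (+<+ (s≤s z≤n))

    4Hρ≤σ : ∀ w → deg w ℕ.≤ h → + 4 * + θ w * H * ρ w ≤ (+ θ w + H - 1ℤ) * σ w
    4Hρ≤σ w d≤h = subst (λ d → + 4 * + θ w * H * ρ w ≤ (+ θ w + H - 1ℤ) * slack H E (deg₂ w) d (+ θ w)) (+θ d≤h)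
      (low-slack H (+ θ w) E (deg₂ w) (+ D)
        (low-bound w (θ w) (proj₁ (two-more (θ w))) (ℕ.m+[n∸m]≡n d≤h) (proj₂ (two-more (θ w))))
        H²≤4D (+≤+ z≤n) (<⇒≤ (c-1>0 w)))

    σ≥0 : ∀ w → 0ℤ ≤ σ w
    σ≥0 w with ℕ.≤-total (deg w) h
    ... | inj₁ d≤h = 0≤cancel (c-1>0 w) (≤-trans (0≤* (0≤* {+ 4 * + θ w} {H} (0≤* {+ 4} {+ θ w} (+≤+ z≤n) (+≤+ z≤n)) H≥0) (ρ≥0 w)) (4Hρ≤σ w d≤h))
    ... | inj₂ h≤d = subst₂ (λ d t → 0ℤ ≤ slack H E (deg₂ w) (+ d) (+ t)) (ℕ.m+[n∸m]≡n h≤d) (sym (ℕ.m≤n⇒m∸n≡0 h≤d))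
      (high-slack H (+ (deg w ℕ.∸ h)) E (deg₂ w) (+ D)
        (high-bound w (deg w ℕ.∸ h) (h ℕ.∸ 1 ℕ.+ (deg w ℕ.∸ h)) (ℕ.m+[n∸m]≡n h≤d)
          (cong (ℕ._+ (deg w ℕ.∸ h)) (sym (ℕ.m+[n∸m]≡n {1} (ℕ.≤-trans (s≤s z≤n) h≥2)))))
        H²≤4D (+≤+ z≤n))

    σ≤0⇒ρ≤0 : ∀ w → deg w ℕ.< h → σ w ≤ 0ℤ → ρ w ≤ 0ℤ
    σ≤0⇒ρ≤0 w d<h σ≤0 = *-cancelˡ-≤-pos (ρ w) 0ℤ (+ 4 * + θ w * H) {{positive factor>0}}
      (subst (+ 4 * + θ w * H * ρ w ≤_) (sym (*-zeroʳ (+ 4 * + θ w * H)))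
        (≤-trans (4Hρ≤σ w (ℕ.<⇒≤ d<h))
          (subst ((+ θ w + H - 1ℤ) * σ w ≤_) (*-zeroʳ (+ θ w + H - 1ℤ))
            (*-monoˡ-≤-nonNeg (+ θ w + H - 1ℤ) {{nonNegative (<⇒≤ (c-1>0 w))}} σ≤0))))
      where
      factor>0 : 0ℤ < + 4 * + θ w * H
      factor>0 = 0<* (0<* {+ 4} {+ θ w} (+<+ (s≤s z≤n)) (+<+ (ℕ.m<n⇒0<n∸m d<h))) H>0

    W : ℤ
    W = + ((2 ℕ.* h) !)

    W>0 : 0ℤ < W
    W>0 = +<+ (ℕ.1≤n! (2 ℕ.* h))

    deg≤n : ∀ u → deg u ℕ.≤ 2 ℕ.* h
    deg≤n u = ℕ.≤-trans (ℕ.m≤m+n (deg u) _) (ℕ.≤-reflexive (card-not (adj G u)))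

    wt : Fin (2 ℕ.* h) → ℤ
    wt u = N!/ (2 ℕ.* h) (deg u)

    wt≥0 : ∀ u → 0ℤ ≤ wt u
    wt≥0 u = 0≤N!/ (2 ℕ.* h) (deg u)

    deg*wt : ∀ u → deg u ≢ 0 → + deg u * wt u ≡ W
    deg*wt u = d*N!/d (2 ℕ.* h) (deg u) (deg≤n u)

    deg-excess : ∀ u → Excess (N * N) (N * + deg u) (N * (+ 2 * + θ u))
    deg-excess u with ℕ.≤-<-connex (deg u) h
    ... | inj₁ d≤h = inj₁ (0≤i-j⇒j≤i (subst (0ℤ ≤_) eq (0≤* (0≤* {+ 2} {H} (+≤+ z≤n) H≥0) (0≤* {+ 2} {+ θ u} (+≤+ z≤n) (+≤+ z≤n)))) , eq)
      where
      identity : ∀ H t → + 2 * H * (+ 2 * t) ≡ + 2 * H * (+ 2 * H) - + 2 * (+ 2 * H * (H - t))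
      identity = solve-∀
      eq : N * (+ 2 * + θ u) ≡ N * N - + 2 * (N * + deg u)
      eq = trans (identity H (+ θ u)) (cong (λ d → N * N - + 2 * (N * d)) (+θ d≤h))
    ... | inj₂ h<d = inj₂
      ( subst₂ _<_ (square H) (swap H (+ deg u))
          (*-monoˡ-<-pos (+ 4 * H) {{positive (0<* {+ 4} (+<+ (s≤s z≤n)) H>0)}} (+<+ h<d))
      , trans (cong (λ t → N * (+ 2 * + t)) (ℕ.m≤n⇒m∸n≡0 (ℕ.<⇒≤ h<d))) (*-zeroʳ N))
      where
      square : ∀ H → + 4 * H * H ≡ + 2 * H * (+ 2 * H)
      square = solve-∀
      swap : ∀ H d → + 4 * H * d ≡ + 2 * (+ 2 * H * d)
      swap = solve-∀


    V : Fin (2 ℕ.* h) → ℤ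
    V u = vertexTerm N E W (+ deg u) (wt u) (+ θ u)

    edge⇒deg≢0 : ∀ u v → adj G u v ≡ true → deg u ≢ 0
    edge⇒deg≢0 u v uv d≡0 = contradiction (ℕ.≤-trans (member v uv) (ℕ.≤-reflexive d≡0)) (λ ())
      where
      member : ∀ {n} {S : Fin n → Bool} v → S v ≡ true → 1 ℕ.≤ card S
      member {S = S} zero    e rewrite e = s≤s z≤n
      member {S = S} (suc v) e with S zero
      ... | true  = s≤s z≤n
      ... | false = member v e

    weightedGap-edge : ∀ u v → adj G u v ≡ true →
      0ℤ ≤ + 16 * (N * N * N) * W * (+ deg u * + deg v) + V u + V v
    weightedGap-edge u v uv =
      weightedGap-nonNeg N E W (+ deg u) (+ deg v) (wt u) (wt v) (+ θ u) (+ θ v) N>0 W>0 (wt≥0 u) (wt≥0 v)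
        (deg*wt u u≢0) (deg*wt v v≢0)
        (edgeGap-nonNeg E (N * N) (N * + deg u) (N * + deg v) (N * (+ 2 * + θ u)) (N * (+ 2 * + θ v)) E≥0
          (0<* N>0 (deg>0 u u≢0)) (0<* N>0 (deg>0 v v≢0)) sum≤n (deg-excess u) (deg-excess v))
      where
      N>0 : 0ℤ < N
      N>0 = 0<* {+ 2} {H} (+<+ (s≤s z≤n)) H>0
      u≢0 = edge⇒deg≢0 u v uv
      v≢0 = edge⇒deg≢0 v u (trans (Graph.sym G v u) uv)
      deg>0 : ∀ u → deg u ≢ 0 → 0ℤ < + deg u
      deg>0 u d≢0 = +<+ (ℕ.n≢0⇒n>0 d≢0)
      sum≤n : N * + deg u + N * + deg v ≤ N * N
      sum≤n = subst (_≤ N * N) (*-distribˡ-+ N (+ deg u) (+ deg v))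
        (*-monoˡ-≤-nonNeg N {{nonNegative (<⇒≤ N>0)}}
          (subst (+ deg u + + deg v ≤_) (sym N≡n) (+≤+ (adj⇒deg+deg≤n u v uv))))

    edges-nonNeg : 0ℤ ≤ sum (λ u → sum (λ v →
      edge G u v * (+ 16 * (N * N * N) * W * (+ deg u * + deg v) + V u + V v)))
    edges-nonNeg = sum-nonNeg (λ u → sum-nonNeg (λ v → pointwise u v _ refl))
      where
      pointwise : ∀ u v b → adj G u v ≡ b →
        0ℤ ≤ 𝟙 b * (+ 16 * (N * N * N) * W * (+ deg u * + deg v) + V u + V v)
      pointwise u v true  uv = 0≤* {1ℤ} (+≤+ z≤n) (weightedGap-edge u v uv)
      pointwise u v false uv = ≤-refl

    edges-sum : sum (λ u → sum (λ v → edge G u v * (+ 16 * (N * N * N) * W * (+ deg u * + deg v) + V u + V v)))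
      ≡ sum (λ u → + 16 * (N * N * N) * W * (+ deg u * deg₂ u) + + 2 * (+ deg u * V u))
    edges-sum = begin
      sum (λ u → sum (λ v → edge G u v * (c * (+ deg u * + deg v) + V u + V v)))
        ≡⟨ sum-cong-≗ (λ u → trans
             (sum-cong-≗ (λ v → expand (edge G u v) c (+ deg u) (+ deg v) (V u) (V v)))
             (trans (∑-distrib-+ (λ v → c * + deg u * (edge G u v * + deg v) + edge G u v * V u) (λ v → edge G u v * V v))
               (cong (λ s → s + sum (λ v → edge G u v * V v))
                 (trans (∑-distrib-+ (λ v → c * + deg u * (edge G u v * + deg v)) (λ v → edge G u v * V u))
                   (cong (λ s → s + sum (λ v → edge G u v * V u))
                     (sym (*-distribˡ-sum (c * + deg u) (λ v → edge G u v * + deg v)))))))) ⟩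
      sum (λ u → c * + deg u * deg₂ u + sum (λ v → edge G u v * V u) + sum (λ v → edge G u v * V v))
        ≡⟨ trans (∑-distrib-+ (λ u → c * + deg u * deg₂ u + sum (λ v → edge G u v * V u)) (λ u → sum (λ v → edge G u v * V v)))
             (cong₂ _+_
               (∑-distrib-+ (λ u → c * + deg u * deg₂ u) (λ u → sum (λ v → edge G u v * V u)))
               (sum-edge-right V)) ⟩
      sum (λ u → c * + deg u * deg₂ u) + sum (λ u → sum (λ v → edge G u v * V u)) + sum (λ u → + deg u * V u)
        ≡⟨ cong (λ s → sum (λ u → c * + deg u * deg₂ u) + s + sum (λ u → + deg u * V u)) (sum-edge-left V) ⟩
      sum (λ u → c * + deg u * deg₂ u) + sum (λ u → + deg u * V u) + sum (λ u → + deg u * V u)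
        ≡⟨ sym (trans (∑-distrib-+ (λ u → c * + deg u * deg₂ u + + deg u * V u) (λ u → + deg u * V u))
             (cong (λ s → s + sum (λ u → + deg u * V u)) (∑-distrib-+ (λ u → c * + deg u * deg₂ u) (λ u → + deg u * V u)))) ⟩
      sum (λ u → c * + deg u * deg₂ u + + deg u * V u + + deg u * V u)
        ≡⟨ sum-cong-≗ (λ u → collect c (+ deg u) (deg₂ u) (V u)) ⟩
      sum (λ u → c * (+ deg u * deg₂ u) + + 2 * (+ deg u * V u)) ∎
      where
      open ≡-Reasoning
      c = + 16 * (N * N * N) * W
      expand : ∀ e c x y p q → e * (c * (x * y) + p + q) ≡ c * x * (e * y) + e * p + e * q
      expand = solve-∀
      collect : ∀ c x s p → c * x * s + x * p + x * p ≡ c * (x * s) + + 2 * (x * p)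
      collect = solve-∀

    -- The parts of the vertex identity containing Λ. In the sum over all vertices they give N α + β
    -- E = 0 whatever Λ is, which is why Λ could be chosen freely.
    α β : ℤ
    α = + 2 * E * Λ E (N * N)
    β = - (+ 4 * Λ E (N * N) * H)

    vertex-bound : ∀ u → + 16 * (N * N * N) * W * (+ deg u * deg₂ u) + + 2 * (+ deg u * V u)
      ≤ W * (α + β * + deg u + - (+ 32 * H * H) * σ u)
    vertex-bound u = go (deg u) (wt u) (deg*wt u)
      where
      vanish : ∀ c s v → c * (0ℤ * s) + + 2 * (0ℤ * v) ≡ 0ℤ
      vanish = solve-∀
      go : ∀ d w → (d ≢ 0 → + d * w ≡ W) →
        + 16 * (N * N * N) * W * (+ d * deg₂ u) + + 2 * (+ d * vertexTerm N E W (+ d) w (+ (h ℕ.∸ d)))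
          ≤ W * (α + β * + d + - (+ 32 * H * H) * slack H E (deg₂ u) (+ d) (+ (h ℕ.∸ d)))
      go (suc d) w eq = ≤-reflexive (vertex-identity H E W (deg₂ u) (+ suc d) w (+ (h ℕ.∸ suc d)) (eq (λ ())))
      go zero    w eq = subst (_≤ W * (α + β * 0ℤ + - (+ 32 * H * H) * slack H E (deg₂ u) 0ℤ H))
        (sym (vanish (+ 16 * (N * N * N) * W) (deg₂ u) (vertexTerm N E W 0ℤ w (+ (h ℕ.∸ 0)))))
        (isolated-bound H E W (deg₂ u) (<⇒≤ W>0) E≥0 H≥0)

    sum-σ≤0 : sum σ ≤ 0ℤ
    sum-σ≤0 = neg-cancel-≤ (0≤cancel {+ 32 * H * H} (0<* (0<* {+ 32} {H} (+<+ (s≤s z≤n)) H>0) H>0)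
      (0≤cancel W>0 (subst (0ℤ ≤_) total
        (≤-trans edges-nonNeg (≤-trans (≤-reflexive edges-sum) (sum-mono vertex-bound))))))
      where
      open ≡-Reasoning
      γ = - (+ 32 * H * H)
      cancel : ∀ H E Λ s → + 2 * H * (+ 2 * E * Λ) + - (+ 4 * Λ * H) * E + - (+ 32 * H * H) * s
        ≡ + 32 * H * H * - s
      cancel = solve-∀
      total : sum (λ u → W * (α + β * + deg u + γ * σ u)) ≡ W * (+ 32 * H * H * - sum σ)
      total = trans (sym (*-distribˡ-sum W (λ u → α + β * + deg u + γ * σ u))) (cong (W *_) (begin
        sum (λ u → α + β * + deg u + γ * σ u)
          ≡⟨ ∑-distrib-+ (λ u → α + β * + deg u) (λ u → γ * σ u) ⟩
        sum (λ u → α + β * + deg u) + sum (λ u → γ * σ u)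
          ≡⟨ cong₂ _+_ (∑-distrib-+ (λ _ → α) (λ u → β * + deg u)) (sym (*-distribˡ-sum γ σ)) ⟩
        sum {2 ℕ.* h} (λ _ → α) + sum (λ u → β * + deg u) + γ * sum σ
          ≡⟨ cong₂ (λ a b → a + b + γ * sum σ)
               (trans (sum-const (2 ℕ.* h) α) (cong (_* α) (sym N≡n)))
               (sym (*-distribˡ-sum β (λ u → + deg u))) ⟩
        N * α + β * E + γ * sum σ
          ≡⟨ cancel H E (Λ E (N * N)) (sum σ) ⟩
        + 32 * H * H * - sum σ ∎))

    σ≤0 : ∀ u → σ u ≤ 0ℤ
    σ≤0 = sum-≤0⇒≤0 σ≥0 sum-σ≤0

  -- The extremal structure

  left? : ∀ {A B : Set} → A ⊎ B → Bool
  left? (inj₁ _) = true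
  left? (inj₂ _) = false

  partition : ∀ {n} (S : Fin n → Bool) →
    Σ (Fin n ↔ (Fin (card S) ⊎ Fin (card (not ∘ S)))) λ f → ∀ i → left? (Inverse.to f i) ≡ S i
  partition {zero}  S = mk↔ₛ′ (λ ()) (λ { (inj₁ ()) ; (inj₂ ()) }) (λ { (inj₁ ()) ; (inj₂ ()) }) (λ ()) , λ ()
  partition {suc n} S with S zero in S₀ | partition (S ∘ suc)
  ... | true | f , f-left = mk↔ₛ′ to from to-from from-to , left
    where
    to : Fin (suc n) → Fin (suc (card (S ∘ suc))) ⊎ Fin (card (not ∘ S ∘ suc))
    to zero    = inj₁ zero
    to (suc i) = Sum.map₁ suc (Inverse.to f i)
    from : Fin (suc (card (S ∘ suc))) ⊎ Fin (card (not ∘ S ∘ suc)) → Fin (suc n)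
    from (inj₁ zero)    = zero
    from (inj₁ (suc x)) = suc (Inverse.from f (inj₁ x))
    from (inj₂ y)       = suc (Inverse.from f (inj₂ y))
    to-from : ∀ x → to (from x) ≡ x
    to-from (inj₁ zero)    = refl
    to-from (inj₁ (suc x)) = cong (Sum.map₁ suc) (Inverse.strictlyInverseˡ f (inj₁ x))
    to-from (inj₂ y)       = cong (Sum.map₁ suc) (Inverse.strictlyInverseˡ f (inj₂ y))
    from-map : ∀ x → from (Sum.map₁ suc x) ≡ suc (Inverse.from f x)
    from-map (inj₁ x) = refl
    from-map (inj₂ y) = refl
    from-to : ∀ i → from (to i) ≡ i
    from-to zero    = refl
    from-to (suc i) = trans (from-map (Inverse.to f i)) (cong suc (Inverse.strictlyInverseʳ f i))
    left-map : ∀ (x : Fin (card (S ∘ suc)) ⊎ Fin (card (not ∘ S ∘ suc))) → left? (Sum.map₁ suc x) ≡ left? x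
    left-map (inj₁ x) = refl
    left-map (inj₂ y) = refl
    left : ∀ i → left? (to i) ≡ S i
    left zero    = sym S₀
    left (suc i) = trans (left-map (Inverse.to f i)) (f-left i)
  ... | false | f , f-left = mk↔ₛ′ to from to-from from-to , left
    where
    to : Fin (suc n) → Fin (card (S ∘ suc)) ⊎ Fin (suc (card (not ∘ S ∘ suc)))
    to zero    = inj₂ zero
    to (suc i) = Sum.map₂ suc (Inverse.to f i)
    from : Fin (card (S ∘ suc)) ⊎ Fin (suc (card (not ∘ S ∘ suc))) → Fin (suc n)
    from (inj₁ x)       = suc (Inverse.from f (inj₁ x))
    from (inj₂ zero)    = zero
    from (inj₂ (suc y)) = suc (Inverse.from f (inj₂ y))
    to-from : ∀ x → to (from x) ≡ x
    to-from (inj₁ x)       = cong (Sum.map₂ suc) (Inverse.strictlyInverseˡ f (inj₁ x))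
    to-from (inj₂ zero)    = refl
    to-from (inj₂ (suc y)) = cong (Sum.map₂ suc) (Inverse.strictlyInverseˡ f (inj₂ y))
    from-map : ∀ x → from (Sum.map₂ suc x) ≡ suc (Inverse.from f x)
    from-map (inj₁ x) = refl
    from-map (inj₂ y) = refl
    from-to : ∀ i → from (to i) ≡ i
    from-to zero    = refl
    from-to (suc i) = trans (from-map (Inverse.to f i)) (cong suc (Inverse.strictlyInverseʳ f i))
    left-map : ∀ (x : Fin (card (S ∘ suc)) ⊎ Fin (card (not ∘ S ∘ suc))) → left? (Sum.map₂ suc x) ≡ left? x
    left-map (inj₁ x) = refl
    left-map (inj₂ y) = refl
    left : ∀ i → left? (to i) ≡ S i
    left zero    = sym S₀
    left (suc i) = trans (left-map (Inverse.to f i)) (f-left i)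

  toℕ-join : ∀ {a b} (x : Fin a ⊎ Fin b) → (toℕ (join a b x) ℕ.<ᵇ a) ≡ left? x
  toℕ-join {a} {b} (inj₁ x) = trans (cong (ℕ._<ᵇ a) (toℕ-↑ˡ x b)) (<⇒true (toℕ<n x))
    where
    <⇒true : ∀ {m n} → m ℕ.< n → (m ℕ.<ᵇ n) ≡ true
    <⇒true (s≤s z≤n)       = refl
    <⇒true (s≤s (s≤s m<n)) = <⇒true (s≤s m<n)
  toℕ-join {a} {b} (inj₂ y) = trans (cong (ℕ._<ᵇ a) (toℕ-↑ʳ a y)) (≥⇒false a (toℕ y))
    where
    ≥⇒false : ∀ a m → (a ℕ.+ m ℕ.<ᵇ a) ≡ false
    ≥⇒false zero    zero    = refl
    ≥⇒false zero    (suc m) = refl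
    ≥⇒false (suc a) m       = ≥⇒false a m

  complete-bipartite : ∀ {n} (G : Graph n) (S : Fin n → Bool) a b → card S ≡ a → card (not ∘ S) ≡ b →
    (∀ u v → adj G u v ≡ S u xor S v) → G ≅ K a b
  complete-bipartite G S _ _ refl refl G-adj with partition S
  ... | f , f-left = ↔-sym +↔⊎ ↔-∘ f , λ u v → trans (G-adj u v) (cong₂ _xor_ (side u) (side v))
    where
    side : ∀ u → S u ≡ (toℕ (join (card S) (card (not ∘ S)) (Inverse.to f u)) ℕ.<ᵇ card S)
    side u = sym (trans (toℕ-join (Inverse.to f u)) (f-left u))

  card>0⇒∃ : ∀ {n} (S : Fin n → Bool) → 1 ℕ.≤ card S → ∃ λ i → S i ≡ true
  card>0⇒∃ {suc n} S h with S zero in S₀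
  ... | true  = zero , S₀
  ... | false = let i , Si = card>0⇒∃ (S ∘ suc) h in suc i , Si

  i*i≤0⇒i≡0 : ∀ i → i * i ≤ 0ℤ → i ≡ 0ℤ
  i*i≤0⇒i≡0 (+ zero)    _        = refl
  i*i≤0⇒i≡0 +[1+ n ]   (+≤+ ())
  i*i≤0⇒i≡0 -[1+ n ]   (+≤+ ())

  module Structure (h : ℕ) (h≥2 : 2 ℕ.≤ h) (G : Graph (2 ℕ.* h)) (tf : TriangleFree G)
    (D : ℕ) (D≤cost : ∀ S → Balanced S → D ℕ.≤ cost G S) (h²≤4D : h ℕ.* h ℕ.≤ 4 ℕ.* D) where

    open Extremal h h≥2 G tf D D≤cost h²≤4D

    deg₂-bound : ∀ w c → (∀ v → adj G w v ≡ true → + deg v ≤ c) → deg₂ w ≤ + deg w * c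
    deg₂-bound w c bound = subst (deg₂ w ≤_)
      (trans (sym (*-distribʳ-sum c (edge G w))) (cong (_* c) (sym (deg-sum w))))
      (sum-mono (λ v → pointwise v _ refl))
      where
      pointwise : ∀ v b → adj G w v ≡ b → 𝟙 b * + deg v ≤ 𝟙 b * c
      pointwise v true  wv = *-monoˡ-≤-nonNeg 1ℤ (bound v wv)
      pointwise v false wv = ≤-refl

    -- Otherwise all degrees are at least h. The ends of an edge have degree sum at most 2 h, and
    -- every vertex lies on an edge, so G is h-regular. Then the slack would be - h⁴.
    low-vertex : ∃ λ w → deg w ℕ.< h
    low-vertex with any? (λ w → deg w ℕ.<? h)
    ... | yes low   = low
    ... | no no-low = ⊥-elim (<⇒≱ (0<* (0<* H>0 H>0) (0<* H>0 H>0)) (neg-cancel-≤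
            (subst (0ℤ ≤_) (trans regular-slack (identity H)) (σ≥0 w₀))))
      where
      deg≥h : ∀ u → h ℕ.≤ deg u
      deg≥h u = ℕ.≮⇒≥ (λ lt → no-low (u , lt))
      deg≡h : ∀ u → deg u ≡ h
      deg≡h u with card>0⇒∃ (adj G u) (ℕ.≤-trans (ℕ.≤-trans (s≤s z≤n) h≥2) (deg≥h u))
      ... | v , uv = ℕ.≤-antisym (ℕ.+-cancelʳ-≤ h (deg u) h
        (ℕ.≤-trans (ℕ.+-monoʳ-≤ (deg u) (deg≥h v))
          (ℕ.≤-trans (adj⇒deg+deg≤n u v uv) (ℕ.≤-reflexive (cong (h ℕ.+_) (ℕ.+-identityʳ h)))))) (deg≥h u)
      E≡ : E ≡ N * H
      E≡ = trans (sum-cong-≗ (λ u → cong +_ (deg≡h u))) (trans (sum-const (2 ℕ.* h) H) (cong (_* H) (sym N≡n)))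
      deg₂≡ : deg₂ w₀ ≡ H * H
      deg₂≡ = trans (sum-cong-≗ (λ v → cong (λ d → edge G w₀ v * + d) (deg≡h v)))
        (trans (sym (*-distribʳ-sum H (edge G w₀))) (cong (_* H) (trans (sym (deg-sum w₀)) (cong +_ (deg≡h w₀)))))
      regular-slack : σ w₀ ≡ slack H (N * H) (H * H) H 0ℤ
      regular-slack = trans (cong (λ d → slack H E (deg₂ w₀) (+ d) (+ (h ℕ.∸ d))) (deg≡h w₀))
        (trans (cong (λ t → slack H E (deg₂ w₀) H (+ t)) (ℕ.n∸n≡0 h)) (cong₂ (λ E s → slack H E s H 0ℤ) E≡ deg₂≡))
      identity : ∀ H → (+ 2 * (+ 2 * H * H) - H * H) * (H * H) + + 4 * H * ((+ 2 * H * H) - H * H) * 0ℤ - + 4 * H * (H * H) * H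
        ≡ - (H * H * (H * H))
      identity = solve-∀

    w : Fin (2 ℕ.* h)
    w = proj₁ low-vertex

    d<h : deg w ℕ.< h
    d<h = proj₂ low-vertex

    ρ≤0 : ρ w ≤ 0ℤ
    ρ≤0 = σ≤0⇒ρ≤0 w d<h (σ≤0 w)

    -- Here c = n - d is the number of vertices outside the neighbourhood of w, and κ = h - d of
    -- them join it on the true side.
    d κ c : ℤ
    d = + deg w
    κ = + θ w
    c = κ + H

    d+κ≡H : d + κ ≡ H
    d+κ≡H = cong +_ (ℕ.m+[n∸m]≡n (ℕ.<⇒≤ d<h))

    c>0 : 0ℤ < c
    c>0 = subst (0ℤ <_) (+-comm H κ) (+-mono-<-≤ H>0 (+≤+ z≤n))

    -- With E = 2 deg₂ w the averaging bound loses its quadratic part.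
    D-bound : + D * c ≤ κ * deg₂ w
    D-bound = *-cancelˡ-≤-pos (+ D * c) (κ * deg₂ w) (+ 2 * (c - 1ℤ)) {{positive (0<* {+ 2} {c - 1ℤ} (+<+ (s≤s z≤n)) (c-1>0 w))}}
      (subst₂ _≤_ (left (+ D) c) (right (pairsOn κ H) κ c (deg₂ w))
        (subst (λ E → + 2 * + D * (c * (c - 1ℤ)) ≤ pairsOn κ H * E + (κ * (c - 1ℤ) - pairsOn κ H) * (+ 2 * deg₂ w))
          (i-j≡0⇒i≡j E (+ 2 * deg₂ w) (≤-antisym ρ≤0 (ρ≥0 w)))
          (low-bound w (θ w) (proj₁ (two-more (θ w))) (ℕ.m+[n∸m]≡n (ℕ.<⇒≤ d<h)) (proj₂ (two-more (θ w))))))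
      where
      left : ∀ D c → + 2 * D * (c * (c - 1ℤ)) ≡ + 2 * (c - 1ℤ) * (D * c)
      left = solve-∀
      right : ∀ q κ c s → q * (+ 2 * s) + (κ * (c - 1ℤ) - q) * (+ 2 * s) ≡ + 2 * (c - 1ℤ) * (κ * s)
      right = solve-∀

    neighbour-deg : ∀ v → adj G w v ≡ true → + deg v ≤ c
    neighbour-deg v wv = +≤+ (ℕ.+-cancelˡ-≤ (deg w) (deg v) (θ w ℕ.+ h)
      (ℕ.≤-trans (adj⇒deg+deg≤n w v wv) (ℕ.≤-reflexive (sym total))))
      where
      total : deg w ℕ.+ (θ w ℕ.+ h) ≡ 2 ℕ.* h
      total = trans (sym (ℕ.+-assoc (deg w) (θ w) h))
        (cong₂ ℕ._+_ (ℕ.m+[n∸m]≡n (ℕ.<⇒≤ d<h)) (sym (ℕ.+-identityʳ h)))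

    deg₂≤dc : deg₂ w ≤ d * c
    deg₂≤dc = deg₂-bound w c neighbour-deg

    4κdeg₂≥ : H * H * c ≤ + 4 * κ * deg₂ w
    4κdeg₂≥ = ≤-trans (*-monoʳ-≤-nonNeg c {{nonNegative (<⇒≤ c>0)}} H²≤4D)
      (subst₂ _≤_ (sym (*-assoc (+ 4) (+ D) c)) (sym (*-assoc (+ 4) κ (deg₂ w)))
        (*-monoˡ-≤-nonNeg (+ 4) D-bound))

    -- With s = `deg₂ w`, the chain is h² c ≤ 4 D c ≤ 4 κ s ≤ 4 κ d c, the last step because
    -- neighbours of w have degree at most n - d = c.
    H²≤4κd : H * H ≤ + 4 * κ * d
    H²≤4κd = ≤cancelʳ c>0 (≤-trans 4κdeg₂≥ (subst (+ 4 * κ * deg₂ w ≤_) (sym (*-assoc (+ 4 * κ) d c))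
      (*-monoˡ-≤-nonNeg (+ 4 * κ) {{nonNegative (0≤* {+ 4} {κ} (+≤+ z≤n) (+≤+ z≤n))}} deg₂≤dc)))

    d≡κ : d ≡ κ
    d≡κ = i-j≡0⇒i≡j d κ (i*i≤0⇒i≡0 (d - κ) (subst (_≤ 0ℤ) (identity d κ)
      (i≤j⇒i-j≤0 (subst (λ H → H * H ≤ + 4 * κ * d) (sym d+κ≡H) H²≤4κd))))
      where
      identity : ∀ d κ → (d + κ) * (d + κ) - + 4 * κ * d ≡ (d - κ) * (d - κ)
      identity = solve-∀

    m : ℕ
    m = deg w

    h≡2m : h ≡ m ℕ.+ m
    h≡2m = trans (sym (ℕ.m+[n∸m]≡n (ℕ.<⇒≤ d<h))) (cong (m ℕ.+_) (sym (+-injective d≡κ)))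

    d>0 : 0ℤ < d
    d>0 = +<+ (ℕ.n≢0⇒n>0 (λ m≡0 → contradiction (subst (2 ℕ.≤_) (trans h≡2m (cong₂ ℕ._+_ m≡0 m≡0)) h≥2) (λ ())))

    H≡2d : H ≡ d + d
    H≡2d = cong +_ h≡2m

    D≤d² : + D ≤ d * d
    D≤d² = ≤cancelʳ c>0 (≤-trans D-bound (subst₂ _≤_ (cong (_* deg₂ w) d≡κ) (sym (*-assoc d d c))
      (*-monoˡ-≤-nonNeg d deg₂≤dc)))

    4D≤h² : 4 ℕ.* D ℕ.≤ h ℕ.* h
    4D≤h² = drop‿+≤+ (subst₂ _≤_ (sym (pos-* 4 D)) (trans (four d) (trans (cong₂ _*_ (sym H≡2d) (sym H≡2d)) (sym (pos-* h h))))
      (*-monoˡ-≤-nonNeg (+ 4) D≤d²))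
      where
      four : ∀ d → + 4 * (d * d) ≡ (d + d) * (d + d)
      four = solve-∀

    -- Now that d = κ, h² = 4 κ d and the chain behind `H²≤4κd` consists of equalities. So every
    -- neighbour of w attains the largest possible degree c.
    dc≤deg₂ : d * c ≤ deg₂ w
    dc≤deg₂ = *-cancelˡ-≤-pos (d * c) (deg₂ w) (+ 4 * d) {{positive (0<* {+ 4} {d} (+<+ (s≤s z≤n)) d>0)}}
      (subst₂ _≤_ (trans (cong (λ H → H * H * c) H≡2d) (identity d c)) (cong (λ κ → + 4 * κ * deg₂ w) (sym d≡κ)) 4κdeg₂≥)
      where
      identity : ∀ d c → (d + d) * (d + d) * c ≡ + 4 * d * (d * c)
      identity = solve-∀

    neighbour-deg≥ : ∀ v → adj G w v ≡ true → c ≤ + deg v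
    neighbour-deg≥ v wv = 0≤i-j⇒j≤i (neg-cancel-≤ (subst (_≤ 0ℤ) (value v wv) (sum-≤0⇒≤0 deficit≥0 deficit-sum v)))
      where
      deficit : Fin (2 ℕ.* h) → ℤ
      deficit u = edge G w u * (c - + deg u)
      deficit≥0 : ∀ u → 0ℤ ≤ deficit u
      deficit≥0 u = go _ refl
        where
        go : ∀ b → adj G w u ≡ b → 0ℤ ≤ 𝟙 b * (c - + deg u)
        go true  wu = 0≤* {1ℤ} (+≤+ z≤n) (i≤j⇒0≤j-i (neighbour-deg u wu))
        go false wu = ≤-refl
      deficit-sum : sum deficit ≤ 0ℤ
      deficit-sum = subst (_≤ 0ℤ) (sym total) (i≤j⇒i-j≤0 dc≤deg₂)
        where
        expand : ∀ e c x → e * (c - x) ≡ e * c + - 1ℤ * (e * x)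
        expand = solve-∀
        collapse : ∀ a s → a + - 1ℤ * s ≡ a - s
        collapse = solve-∀
        total : sum deficit ≡ d * c - deg₂ w
        total = trans (sum-cong-≗ (λ u → expand (edge G w u) c (+ deg u)))
          (trans (∑-distrib-+ (λ u → edge G w u * c) (λ u → - 1ℤ * (edge G w u * + deg u)))
            (trans (cong₂ _+_
              (trans (sym (*-distribʳ-sum c (edge G w))) (cong (_* c) (sym (deg-sum w))))
              (sym (*-distribˡ-sum (- 1ℤ) (λ u → edge G w u * + deg u))))
              (collapse (d * c) (deg₂ w))))
      value : ∀ v → adj G w v ≡ true → deficit v ≡ - (+ deg v - c)
      value v wv rewrite wv = flip (+ deg v) c
        where
        flip : ∀ x c → 1ℤ * (c - x) ≡ - (x - c)
        flip = solve-∀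

    -- The neighbourhoods of w and u are disjoint and have d + c = n elements together, so a vertex
    -- outside the first lies in the second. The terms `missing` indicate vertices in neither.
    cross : ∀ u v → adj G w u ≡ true → adj G w v ≡ false → adj G u v ≡ true
    cross u v wu wv with adj G u v in uv
    ... | true  = refl
    ... | false = ⊥-elim (<⇒≱ (+<+ (s≤s z≤n)) (subst (_≤ 0ℤ) value (sum-≤0⇒≤0 missing≥0 missing-sum v)))
      where
      missing : Fin (2 ℕ.* h) → ℤ
      missing x = 1ℤ + - 1ℤ * (edge G w x + edge G u x)
      missing≥0 : ∀ x → 0ℤ ≤ missing x
      missing≥0 x = go _ _ refl refl
        where
        go : ∀ a b → adj G w x ≡ a → adj G u x ≡ b → 0ℤ ≤ 1ℤ + - 1ℤ * (𝟙 a + 𝟙 b)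
        go true  true  wx ux = no-triangle wu wx ux
        go true  false wx ux = ≤-refl
        go false true  wx ux = ≤-refl
        go false false wx ux = +≤+ z≤n
      value : missing v ≡ 1ℤ
      value rewrite wv | uv = refl
      missing-sum : sum missing ≤ 0ℤ
      missing-sum = subst (_≤ 0ℤ) (sym total) (subst (λ n → n - (d + + deg u) ≤ 0ℤ) (sym d+c≡N)
        (subst (_≤ 0ℤ) (cancel d c (+ deg u)) (i≤j⇒i-j≤0 (neighbour-deg≥ u wu))))
        where
        cancel : ∀ d c x → c - x ≡ d + c - (d + x)
        cancel = solve-∀
        assoc : ∀ d κ H → d + κ + H ≡ d + (κ + H)
        assoc = solve-∀
        double-H : ∀ H → + 2 * H ≡ H + H
        double-H = solve-∀
        d+c≡N : N ≡ d + c
        d+c≡N = trans (double-H H) (trans (cong (_+ H) (sym d+κ≡H)) (assoc d κ H))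
        simplify : ∀ n s → n * 1ℤ + - 1ℤ * s ≡ n - s
        simplify = solve-∀
        total : sum missing ≡ N - (d + + deg u)
        total = trans (∑-distrib-+ (λ _ → 1ℤ) (λ x → - 1ℤ * (edge G w x + edge G u x)))
          (trans (cong₂ _+_ (trans (sum-const (2 ℕ.* h) 1ℤ) (cong (_* 1ℤ) (sym N≡n)))
            (trans (sym (*-distribˡ-sum (- 1ℤ) (λ x → edge G w x + edge G u x)))
              (cong (- 1ℤ *_) (trans (∑-distrib-+ (edge G w) (edge G u))
                (cong₂ _+_ (sym (deg-sum w)) (sym (deg-sum u)))))))
            (simplify N (d + + deg u)))

    -- Stated for the complement of the neighbourhood, since `K (3 m) m` lists its larger class
    -- first and w has only m neighbours.
    adj-xor : ∀ u v → adj G u v ≡ not (adj G w u) xor not (adj G w v)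
    adj-xor u v = go _ _ _ refl refl refl
      where
      go : ∀ a b e → adj G w u ≡ a → adj G w v ≡ b → adj G u v ≡ e → e ≡ not a xor not b
      go true  true  true  wu wv uv = no-triangle wu wv uv
      go true  true  false wu wv uv = refl
      go true  false e     wu wv uv = trans (sym uv) (cross u v wu wv)
      go false true  e     wu wv uv = trans (sym uv) (trans (Graph.sym G u v) (cross v u wv wu))
      go false false e     wu wv uv = trans (sym uv) (ρ≤0⇒independent w ρ≤0 u v wu wv)

    2h≡4m : 2 ℕ.* h ≡ 4 ℕ.* m
    2h≡4m = trans (cong (2 ℕ.*_) h≡2m) (identity m)
      where
      identity : ∀ m → 2 ℕ.* (m ℕ.+ m) ≡ 4 ℕ.* m
      identity = ℕSolver.solve-∀

    G≅K : G ≅ K (3 ℕ.* m) m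
    G≅K = complete-bipartite G (not ∘ adj G w) (3 ℕ.* m) m outside-size inside-size adj-xor
      where
      outside-size : card (not ∘ adj G w) ≡ 3 ℕ.* m
      outside-size = ℕ.+-cancelˡ-≡ m _ _ (trans (card-not (adj G w)) 2h≡4m)
      inside-size : card (not ∘ (not ∘ adj G w)) ≡ m
      inside-size = ℕ.+-cancelˡ-≡ (3 ℕ.* m) _ _
        (trans (cong (ℕ._+ card (not ∘ (not ∘ adj G w))) (sym outside-size))
          (trans (card-not (not ∘ adj G w)) (trans 2h≡4m (identity m))))
        where
        identity : ∀ m → 4 ℕ.* m ≡ 3 ℕ.* m ℕ.+ m
        identity = ℕSolver.solve-∀

open import Data.Nat using (ℕ; _+_; _*_; _≤_; _≥_)
open import Data.Nat.Properties
  using (≤-total; ≤-reflexive; *-cancelˡ-≤; *-monoʳ-≤; module ≤-Reasoning)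
open import Data.Nat.Tactic.RingSolver using (solve-∀)
open import Data.Product using (Σ; _×_; _,_; proj₂)
open import Data.Sum using ([_,_]′)
open import Relation.Binary.PropositionalEquality using (_≡_; trans; sym)

theorem1p1 : Σ ℕ λ n₀ → ∀ (h : ℕ) → 2 * h ≥ n₀ → (G : Graph (2 * h)) → TriangleFree G →
    (∀ D → IsD2b G D → 16 * D ≤ (2 * h) * (2 * h))
    × (∀ D → IsD2b G D → 16 * D ≡ (2 * h) * (2 * h) →
    Σ ℕ λ m → Σ (2 * h ≡ 4 * m) λ _ → G ≅ K (3 * m) m)
-- The value 4 means h ≥ 2, which leaves at least two free vertices around every vertex of low
-- degree (`two-more`).
theorem1p1 = 4 , λ h 2h≥4 G tf →
  let h≥2 = *-cancelˡ-≤ 2 2h≥4 in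
  (λ D isD → begin
    16 * D            ≡⟨ 16≡4*4 D ⟩
    4 * (4 * D)       ≤⟨ *-monoʳ-≤ 4
                           -- Either 4 D ≤ h² already, or h² ≤ 4 D puts G into the extremal case,
                           -- where D is at most d² = h² / 4.
                           ([ Proof.Structure.4D≤h² h h≥2 G tf D (proj₂ isD) , (λ le → le) ]′ (≤-total (h * h) (4 * D))) ⟩
    4 * (h * h)       ≡⟨ square h ⟩
    (2 * h) * (2 * h) ∎) ,
  (λ D isD eq →
    let open Proof.Structure h h≥2 G tf D (proj₂ isD)
          (*-cancelˡ-≤ 4 (≤-reflexive (trans (square h) (trans (sym eq) (16≡4*4 D)))))
    in m , 2h≡4m , G≅K)
  where
  open ≤-Reasoning
  16≡4*4 : ∀ D → 16 * D ≡ 4 * (4 * D)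
  16≡4*4 = solve-∀
  square : ∀ h → 4 * (h * h) ≡ (2 * h) * (2 * h)
  square = solve-∀
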